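{- Let $\lambda\in\mathbb{R}$. For every integer $p\ge 0$, as an identity of power series in $t$, $$\sum_{n=0}^{\infty}\beta_{n,\lambda}^{(p)}\frac{t^{n}}{n!}=(p+1)\int_{0}^{1}(1-x)^{p}\big(1-x(1-e_{\lambda}(t))\big)^{\lambda-1}\,dx.$$
   Context: For real $\mu$ and $x$: $(x)_{0,\mu}=1$ and $(x)_{n,\mu}=x(x-\mu)(x-2\mu)\cdots(x-(n-1)\mu)$ for $n\ge 1$. Also $\langle a\rangle_0=1$, $\langle a\rangle_k=a(a+1)\cdots(a+k-1)$ for $k\ge1$. The degenerate exponential is the power series $e_\lambda(t)=\sum_{n\ge0}(1)_{n,\lambda}\frac{t^n}{n!}$. The Gauss hypergeometric series is ${}_2F_1(a,b;c;x)=\sum_{k\ge0}\frac{\langle a\rangle_k\langle b\rangle_k}{\langle c\rangle_k}\frac{x^k}{k!}$. For an integer $p\ge-1$, the generalized degenerate Bernoulli numbers $\beta_{n,\lambda}^{(p)}$ ($n\ge0$) are defined by the identity of formal power series in $t$ $${}_2F_1\big(1-\lambda,1;p+2;1-e_\lambda(t)\big)=\sum_{n=0}^\infty\beta_{n,\lambda}^{(p)}\frac{t^n}{n!}.$$ On the right-hand side of the claim, $\big(1-x(1-e_\lambda(t))\big)^{\lambda-1}$ is expanded by the binomial series $\sum_{k\ge0}\binom{\lambda-1}{k}(-x)^k(1-e_\lambda(t))^k$ as a power series in $t$ whose coefficients are polynomials in $x$, and the integral over $x\in[0,1]$ is taken coefficientwise. -}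

module Defs where

open import Algebra.Bundles using (CommutativeRing)
open import Algebra.Definitions using (Invertible)
open import Data.Fin.Base as Fin using (Fin; zero; suc; toℕ; inject₁)
open import Data.Integer.Base as ℤ using (ℤ; +_; -[1+_]; -1ℤ)
import Data.Integer.Properties as ℤₚ
open import Data.Nat.Base as ℕ using (ℕ; zero; suc; _∸_; _!; _⊔_)
import Data.Nat.Properties as ℕₚ
open import Data.Product.Base using (∃-syntax; _×_; _,_; proj₁; proj₂)
open import Data.Rational.Base as ℚ using (ℚ; 0ℚ; 1ℚ; ½)
import Data.Rational.Properties as ℚₚ
open import Data.Rational.Solver using (module +-*-Solver)
import Data.Rational.Unnormalised.Base as ℚᵘ
import Data.Rational.Unnormalised.Properties as ℚᵘₚ
open import Function.Base using (_$_)
open import Level using (0ℓ)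
open import Relation.Binary.PropositionalEquality.Core as ≡ using (_≡_)

IsCauchy : (ℕ → ℚ) → Set
IsCauchy s = ∀ ε → 0ℚ ℚ.< ε →
  ∃[ N ] (∀ m n → N ℕ.≤ m → N ℕ.≤ n → ℚ.∣ s m ℚ.- s n ∣ ℚ.< ε)

record ℝ : Set where
  constructor mkℝ
  field
    seq    : ℕ → ℚ
    cauchy : IsCauchy seq

open ℝ public

Eventually : (ℕ → Set) → Set
Eventually P = ∃[ N ] (∀ n → N ℕ.≤ n → P n)

infix 4 _≈ᴿ_ _≤ᴿ_

record _≈ᴿ_ (x y : ℝ) : Set where
  constructor mk≈
  field
    close : ∀ ε → 0ℚ ℚ.< ε → Eventually (λ n → ℚ.∣ seq x n ℚ.- seq y n ∣ ℚ.< ε)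

-- Non-strict, so a tolerance is needed: x ≤ y need not hold termwise.
record _≤ᴿ_ (x y : ℝ) : Set where
  constructor mk≤
  field
    below : ∀ ε → 0ℚ ℚ.< ε → Eventually (λ n → seq x n ℚ.≤ seq y n ℚ.+ ε)

open _≈ᴿ_ public
open _≤ᴿ_ public

private
  open +-*-Solver

  half : ∀ {ε} → 0ℚ ℚ.< ε → 0ℚ ℚ.< ½ ℚ.* ε
  half {ε} 0<ε = ℚₚ.positive⁻¹ (½ ℚ.* ε)
    where instance _ = ℚₚ.pos*pos⇒pos ½ ε {{ℚ.positive 0<ε}}

  half+half : ∀ ε → ½ ℚ.* ε ℚ.+ ½ ℚ.* ε ≡ ε
  half+half ε = ≡.trans (≡.sym (ℚₚ.*-distribʳ-+ ε ½ ½)) (ℚₚ.*-identityˡ ε)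

  ∣p-q∣≡∣q-p∣ : ∀ p q → ℚ.∣ p ℚ.- q ∣ ≡ ℚ.∣ q ℚ.- p ∣
  ∣p-q∣≡∣q-p∣ p q = ≡.trans (≡.sym (ℚₚ.∣-p∣≡∣p∣ (p ℚ.- q)))
    (≡.cong ℚ.∣_∣ (solve 2 (λ a b → :- (a :- b) := b :- a) ≡.refl p q))

  near-trans : ∀ p q r {δ δ′} → ℚ.∣ p ℚ.- q ∣ ℚ.< δ → ℚ.∣ q ℚ.- r ∣ ℚ.< δ′ →
               ℚ.∣ p ℚ.- r ∣ ℚ.< δ ℚ.+ δ′
  near-trans p q r pq qr = ℚₚ.≤-<-trans
    (≡.subst (λ z → ℚ.∣ z ∣ ℚ.≤ ℚ.∣ p ℚ.- q ∣ ℚ.+ ℚ.∣ q ℚ.- r ∣)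
      (solve 3 (λ a b c → (a :- b) :+ (b :- c) := a :- c) ≡.refl p q r)
      (ℚₚ.∣p+q∣≤∣p∣+∣q∣ (p ℚ.- q) (q ℚ.- r)))
    (ℚₚ.+-mono-< pq qr)

  near-+ : ∀ p p′ q q′ {δ δ′} → ℚ.∣ p ℚ.- p′ ∣ ℚ.< δ → ℚ.∣ q ℚ.- q′ ∣ ℚ.< δ′ →
           ℚ.∣ (p ℚ.+ q) ℚ.- (p′ ℚ.+ q′) ∣ ℚ.< δ ℚ.+ δ′
  near-+ p p′ q q′ pp qq = ℚₚ.≤-<-trans
    (≡.subst (λ z → ℚ.∣ z ∣ ℚ.≤ ℚ.∣ p ℚ.- p′ ∣ ℚ.+ ℚ.∣ q ℚ.- q′ ∣)
      (solve 4 (λ a b c d → (a :- b) :+ (c :- d) := (a :+ c) :- (b :+ d)) ≡.refl p p′ q q′)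
      (ℚₚ.∣p+q∣≤∣p∣+∣q∣ (p ℚ.- p′) (q ℚ.- q′)))
    (ℚₚ.+-mono-< pp qq)

  near-neg : ∀ p q {δ} → ℚ.∣ p ℚ.- q ∣ ℚ.< δ → ℚ.∣ (ℚ.- p) ℚ.- (ℚ.- q) ∣ ℚ.< δ
  near-neg p q {δ} = ≡.subst (ℚ._< δ) $ ≡.trans (∣p-q∣≡∣q-p∣ p q)
    (≡.cong ℚ.∣_∣ (solve 2 (λ a b → b :- a := (:- a) :- (:- b)) ≡.refl p q))

  near-abs : ∀ p q {δ} → ℚ.∣ p ℚ.- q ∣ ℚ.< δ → ℚ.∣ ℚ.∣ p ∣ ℚ.- ℚ.∣ q ∣ ∣ ℚ.< δ
  near-abs p q pq = ℚₚ.≤-<-trans (bound (ℚₚ.∣p∣≡p∨∣p∣≡-p (ℚ.∣ p ∣ ℚ.- ℚ.∣ q ∣))) pq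
    where
    open import Data.Sum.Base using (_⊎_; inj₁; inj₂)

    diff : ∀ a b → ℚ.∣ a ∣ ℚ.- ℚ.∣ b ∣ ℚ.≤ ℚ.∣ a ℚ.- b ∣
    diff a b = ≡.subst (ℚ.∣ a ∣ ℚ.- ℚ.∣ b ∣ ℚ.≤_)
      (solve 2 (λ s t → (s :+ t) :- t := s) ≡.refl ℚ.∣ a ℚ.- b ∣ ℚ.∣ b ∣)
      (ℚₚ.+-monoˡ-≤ (ℚ.- ℚ.∣ b ∣)
        (≡.subst (λ z → ℚ.∣ z ∣ ℚ.≤ ℚ.∣ a ℚ.- b ∣ ℚ.+ ℚ.∣ b ∣)
          (solve 2 (λ s t → (s :- t) :+ t := s) ≡.refl a b)
          (ℚₚ.∣p+q∣≤∣p∣+∣q∣ (a ℚ.- b) b)))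

    bound : let d = ℚ.∣ p ∣ ℚ.- ℚ.∣ q ∣ in
            ℚ.∣ d ∣ ≡ d ⊎ ℚ.∣ d ∣ ≡ ℚ.- d → ℚ.∣ d ∣ ℚ.≤ ℚ.∣ p ℚ.- q ∣
    bound (inj₁ e) = ≡.subst (ℚ._≤ ℚ.∣ p ℚ.- q ∣) (≡.sym e) (diff p q)
    bound (inj₂ e) = ≡.subst₂ ℚ._≤_
      (≡.sym (≡.trans e (solve 2 (λ s t → :- (s :- t) := t :- s) ≡.refl ℚ.∣ p ∣ ℚ.∣ q ∣)))
      (∣p-q∣≡∣q-p∣ q p) (diff q p)

  near-* : ∀ {C δ} p p′ q q′ → 0ℚ ℚ.< C → ℚ.∣ p ∣ ℚ.≤ C → ℚ.∣ q′ ∣ ℚ.≤ C →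
           ℚ.∣ p ℚ.- p′ ∣ ℚ.< δ → ℚ.∣ q ℚ.- q′ ∣ ℚ.< δ →
           ℚ.∣ (p ℚ.* q) ℚ.- (p′ ℚ.* q′) ∣ ℚ.< C ℚ.* δ ℚ.+ C ℚ.* δ
  near-* {C} {δ} p p′ q q′ 0<C p≤C q′≤C pp qq = ℚₚ.≤-<-trans
    (≡.subst (λ z → ℚ.∣ z ∣ ℚ.≤ ℚ.∣ p ℚ.* (q ℚ.- q′) ∣ ℚ.+ ℚ.∣ q′ ℚ.* (p ℚ.- p′) ∣)
      (solve 4 (λ a b c d → a :* (c :- d) :+ d :* (a :- b) := a :* c :- b :* d)
        ≡.refl p p′ q q′)
      (ℚₚ.∣p+q∣≤∣p∣+∣q∣ (p ℚ.* (q ℚ.- q′)) (q′ ℚ.* (p ℚ.- p′))))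
    (ℚₚ.+-mono-< (part p (q ℚ.- q′) p≤C qq) (part q′ (p ℚ.- p′) q′≤C pp))
    where
    part : ∀ a b → ℚ.∣ a ∣ ℚ.≤ C → ℚ.∣ b ∣ ℚ.< δ → ℚ.∣ a ℚ.* b ∣ ℚ.< C ℚ.* δ
    part a b a≤C b<δ = ≡.subst (ℚ._< C ℚ.* δ) (≡.sym (ℚₚ.∣p*q∣≡∣p∣*∣q∣ a b))
      (ℚₚ.≤-<-trans
        (ℚₚ.*-monoʳ-≤-nonNeg ℚ.∣ b ∣ {{ℚₚ.∣-∣-nonNeg b}} a≤C)
        (ℚₚ.*-monoʳ-<-pos C {{ℚ.positive 0<C}} b<δ))

  scaled : ∀ C ε → .{{_ : ℚ.NonZero C}} →
           C ℚ.* ((ℚ.1/ C) ℚ.* (½ ℚ.* ε)) ≡ ½ ℚ.* ε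
  scaled C ε = ≡.trans (≡.sym (ℚₚ.*-assoc C (ℚ.1/ C) (½ ℚ.* ε)))
    (≡.trans (≡.cong (ℚ._* (½ ℚ.* ε)) (ℚₚ.*-inverseʳ C)) (ℚₚ.*-identityˡ (½ ℚ.* ε)))

  abstract
    small : ∀ C ε → 0ℚ ℚ.< C → 0ℚ ℚ.< ε →
            ∃[ δ ] (0ℚ ℚ.< δ × C ℚ.* δ ℚ.+ C ℚ.* δ ≡ ε)
    small C ε 0<C 0<ε =
      (ℚ.1/ C) ℚ.* (½ ℚ.* ε) ,
      ℚₚ.positive⁻¹ _ {{ℚₚ.pos*pos⇒pos (ℚ.1/ C) (½ ℚ.* ε)}} ,
      ≡.trans (≡.cong₂ ℚ._+_ (scaled C ε) (scaled C ε)) (half+half ε)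
      where
      instance
        C-positive : ℚ.Positive C
        C-positive = ℚ.positive 0<C
        C-nonZero : ℚ.NonZero C
        C-nonZero = ℚₚ.pos⇒nonZero C
        C⁻¹-positive : ℚ.Positive (ℚ.1/ C)
        C⁻¹-positive = ℚₚ.1/pos⇒pos C
        ½ε-positive : ℚ.Positive (½ ℚ.* ε)
        ½ε-positive = ℚ.positive (half 0<ε)

  eventually-× : ∀ {P Q : ℕ → Set} → Eventually P → Eventually Q →
                 Eventually (λ n → P n × Q n)
  eventually-× (M , p) (N , q) = M ⊔ N , λ n M⊔N≤n →
    p n (ℕₚ.m⊔n≤o⇒m≤o M N M⊔N≤n) , q n (ℕₚ.m⊔n≤o⇒n≤o M N M⊔N≤n)

  eventually-map : ∀ {P Q : ℕ → Set} → (∀ {n} → P n → Q n) → Eventually P → Eventually Q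
  eventually-map f (N , p) = N , λ n N≤n → f (p n N≤n)

  pos+nonNeg : ∀ {p q} → 0ℚ ℚ.< p → 0ℚ ℚ.≤ q → 0ℚ ℚ.< p ℚ.+ q
  pos+nonNeg {p} {q} 0<p 0≤q = ℚₚ.<-≤-trans 0<p
    (≡.subst (ℚ._≤ p ℚ.+ q) (ℚₚ.+-identityʳ p) (ℚₚ.+-monoʳ-≤ p 0≤q))

  near-bound : ∀ p q {δ} → ℚ.∣ p ℚ.- q ∣ ℚ.< δ → ℚ.∣ p ∣ ℚ.≤ δ ℚ.+ ℚ.∣ q ∣
  near-bound p q pq = ℚₚ.≤-trans
    (≡.subst (λ z → ℚ.∣ z ∣ ℚ.≤ ℚ.∣ p ℚ.- q ∣ ℚ.+ ℚ.∣ q ∣)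
      (solve 2 (λ s t → (s :- t) :+ t := s) ≡.refl p q)
      (ℚₚ.∣p+q∣≤∣p∣+∣q∣ (p ℚ.- q) q))
    (ℚₚ.+-monoˡ-≤ ℚ.∣ q ∣ (ℚₚ.<⇒≤ pq))

  abstract
    bounded-by : ∀ x δ → 0ℚ ℚ.< δ →
                 ∃[ C ] (0ℚ ℚ.< C × Eventually (λ n → ℚ.∣ seq x n ∣ ℚ.≤ C))
    bounded-by x δ 0<δ with cauchy x δ 0<δ
    ... | N , near = δ ℚ.+ ℚ.∣ seq x N ∣
        , pos+nonNeg 0<δ (ℚₚ.0≤∣p∣ (seq x N))
        , N , λ n N≤n → near-bound (seq x n) (seq x N) (near n N N≤n ℕₚ.≤-refl)

    bounded : ∀ x → ∃[ C ] (0ℚ ℚ.< C × Eventually (λ n → ℚ.∣ seq x n ∣ ℚ.≤ C))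
    bounded x = bounded-by x 1ℚ (ℚₚ.positive⁻¹ 1ℚ)

  Bound : (ℕ → ℚ) → ℚ → Set
  Bound s C = Eventually (λ n → ℚ.∣ s n ∣ ℚ.≤ C)

  common-bound : ∀ {s t} → ∃[ A ] (0ℚ ℚ.< A × Bound s A) → ∃[ B ] (0ℚ ℚ.< B × Bound t B) →
                 ∃[ C ] (0ℚ ℚ.< C × Bound s C × Bound t C)
  common-bound (A , 0<A , sA) (B , 0<B , tB) = A ℚ.+ B
      , pos+nonNeg 0<A (ℚₚ.<⇒≤ 0<B)
      , eventually-map (λ p → ℚₚ.≤-trans p A≤A+B) sA
      , eventually-map (λ p → ℚₚ.≤-trans p B≤A+B) tB
    where
    A≤A+B : A ℚ.≤ A ℚ.+ B
    A≤A+B = ≡.subst (ℚ._≤ A ℚ.+ B) (ℚₚ.+-identityʳ A) (ℚₚ.+-monoʳ-≤ A (ℚₚ.<⇒≤ 0<B))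
    B≤A+B : B ℚ.≤ A ℚ.+ B
    B≤A+B = ≡.subst (ℚ._≤ A ℚ.+ B) (ℚₚ.+-identityˡ B) (ℚₚ.+-monoˡ-≤ B (ℚₚ.<⇒≤ 0<A))

  abstract
    bounded₂ : ∀ x y → ∃[ C ] (0ℚ ℚ.< C × Bound (seq x) C × Bound (seq y) C)
    bounded₂ x y = common-bound (bounded x) (bounded y)

  join₂ : ∀ {P Q S : ℕ → ℕ → Set} → (∀ {m n} → P m n → Q m n → S m n) →
          ∃[ M ] (∀ m n → M ℕ.≤ m → M ℕ.≤ n → P m n) →
          ∃[ N ] (∀ m n → N ℕ.≤ m → N ℕ.≤ n → Q m n) →
          ∃[ K ] (∀ m n → K ℕ.≤ m → K ℕ.≤ n → S m n)
  join₂ f (M , p) (N , q) = M ⊔ N , λ m n m≥ n≥ → f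
    (p m n (ℕₚ.m⊔n≤o⇒m≤o M N m≥) (ℕₚ.m⊔n≤o⇒m≤o M N n≥))
    (q m n (ℕₚ.m⊔n≤o⇒n≤o M N m≥) (ℕₚ.m⊔n≤o⇒n≤o M N n≥))

  map₂ : ∀ {P Q : ℕ → ℕ → Set} → (∀ {m n} → P m n → Q m n) →
         ∃[ M ] (∀ m n → M ℕ.≤ m → M ℕ.≤ n → P m n) →
         ∃[ M ] (∀ m n → M ℕ.≤ m → M ℕ.≤ n → Q m n)
  map₂ f (M , p) = M , λ m n m≥ n≥ → f (p m n m≥ n≥)

  both : ∀ {P Q : ℕ → Set} → Eventually P → Eventually Q →
         ∃[ K ] (∀ m n → K ℕ.≤ m → K ℕ.≤ n → P m × Q n)
  both (M , p) (N , q) = M ⊔ N , λ m n m≥ n≥ →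
    p m (ℕₚ.m⊔n≤o⇒m≤o M N m≥) , q n (ℕₚ.m⊔n≤o⇒n≤o M N n≥)

  abstract
    cauchy-ι : ∀ q → IsCauchy (λ _ → q)
    cauchy-ι q ε 0<ε = 0 , λ _ _ _ _ →
      ≡.subst (λ z → ℚ.∣ z ∣ ℚ.< ε) (≡.sym (ℚₚ.+-inverseʳ q)) 0<ε

    cauchy-+ : ∀ s t → IsCauchy s → IsCauchy t → IsCauchy (λ n → s n ℚ.+ t n)
    cauchy-+ s t cs ct ε 0<ε = join₂
      (λ {m} {n} a b → ≡.subst (ℚ.∣ (s m ℚ.+ t m) ℚ.- (s n ℚ.+ t n) ∣ ℚ.<_) (half+half ε)
        (near-+ (s m) (s n) (t m) (t n) a b))
      (cs (½ ℚ.* ε) (half 0<ε)) (ct (½ ℚ.* ε) (half 0<ε))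

    cauchy-neg : ∀ s → IsCauchy s → IsCauchy (λ n → ℚ.- s n)
    cauchy-neg s cs ε 0<ε = map₂ (λ {m} {n} → near-neg (s m) (s n)) (cs ε 0<ε)

    cauchy-abs : ∀ s → IsCauchy s → IsCauchy (λ n → ℚ.∣ s n ∣)
    cauchy-abs s cs ε 0<ε = map₂ (λ {m} {n} → near-abs (s m) (s n)) (cs ε 0<ε)

    cauchy-* : ∀ s t → ∃[ C ] (0ℚ ℚ.< C × Bound s C × Bound t C) →
               IsCauchy s → IsCauchy t → IsCauchy (λ n → s n ℚ.* t n)
    cauchy-* s t (C , 0<C , sC , tC) cs ct ε 0<ε = go (small C ε 0<C 0<ε)
      where
      go : ∃[ δ ] (0ℚ ℚ.< δ × C ℚ.* δ ℚ.+ C ℚ.* δ ≡ ε) →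
           ∃[ N ] (∀ m n → N ℕ.≤ m → N ℕ.≤ n → ℚ.∣ s m ℚ.* t m ℚ.- s n ℚ.* t n ∣ ℚ.< ε)
      go (δ , 0<δ , eq) = join₂
        (λ {m} {n} (a , b) (c , d) →
          ≡.subst (ℚ.∣ s m ℚ.* t m ℚ.- s n ℚ.* t n ∣ ℚ.<_) eq
            (near-* (s m) (s n) (t m) (t n) 0<C a b c d))
        (both sC tC) (join₂ _,_ (cs δ 0<δ) (ct δ 0<δ))

infixl 6 _+ᴿ_
infixl 7 _*ᴿ_
infix 8 -ᴿ_

ι : ℚ → ℝ
ι q = mkℝ (λ _ → q) (cauchy-ι q)

_+ᴿ_ : ℝ → ℝ → ℝ
x +ᴿ y = mkℝ (λ n → seq x n ℚ.+ seq y n) (cauchy-+ (seq x) (seq y) (cauchy x) (cauchy y))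

-ᴿ_ : ℝ → ℝ
-ᴿ x = mkℝ (λ n → ℚ.- seq x n) (cauchy-neg (seq x) (cauchy x))

_*ᴿ_ : ℝ → ℝ → ℝ
x *ᴿ y = mkℝ (λ n → seq x n ℚ.* seq y n)
  (cauchy-* (seq x) (seq y) (bounded₂ x y) (cauchy x) (cauchy y))

∣_∣ : ℝ → ℝ
∣ x ∣ = mkℝ (λ n → ℚ.∣ seq x n ∣) (cauchy-abs (seq x) (cauchy x))

pointwise : ∀ {x y} → (∀ n → seq x n ≡ seq y n) → x ≈ᴿ y
pointwise {x} {y} eq .close ε 0<ε = 0 , λ n _ →
  ≡.subst (λ z → ℚ.∣ z ∣ ℚ.< ε)
    (≡.sym (≡.trans (≡.cong (ℚ._- seq y n) (eq n)) (ℚₚ.+-inverseʳ (seq y n)))) 0<ε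

private
  ≈-sym : ∀ {x y} → x ≈ᴿ y → y ≈ᴿ x
  ≈-sym {x} {y} p .close ε 0<ε = eventually-map
    (λ {n} → ≡.subst (ℚ._< ε) (∣p-q∣≡∣q-p∣ (seq x n) (seq y n))) (close p ε 0<ε)

  ≈-trans : ∀ {x y z} → x ≈ᴿ y → y ≈ᴿ z → x ≈ᴿ z
  ≈-trans {x} {y} {z} p q .close ε 0<ε = eventually-map
    (λ {n} (a , b) → ≡.subst (ℚ.∣ seq x n ℚ.- seq z n ∣ ℚ.<_) (half+half ε)
      (near-trans (seq x n) (seq y n) (seq z n) a b))
    (eventually-× (close p _ (half 0<ε)) (close q _ (half 0<ε)))

  +-cong : ∀ {x x′ y y′} → x ≈ᴿ x′ → y ≈ᴿ y′ → x +ᴿ y ≈ᴿ x′ +ᴿ y′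
  +-cong {x} {x′} {y} {y′} p q .close ε 0<ε = eventually-map
    (λ {n} (a , b) → ≡.subst
      (ℚ.∣ (seq x n ℚ.+ seq y n) ℚ.- (seq x′ n ℚ.+ seq y′ n) ∣ ℚ.<_) (half+half ε)
      (near-+ (seq x n) (seq x′ n) (seq y n) (seq y′ n) a b))
    (eventually-× (close p _ (half 0<ε)) (close q _ (half 0<ε)))

  neg-cong : ∀ {x x′} → x ≈ᴿ x′ → -ᴿ x ≈ᴿ -ᴿ x′
  neg-cong {x} {x′} p .close ε 0<ε = eventually-map
    (λ {n} → near-neg (seq x n) (seq x′ n)) (close p ε 0<ε)

  *-cong : ∀ {x x′ y y′} → x ≈ᴿ x′ → y ≈ᴿ y′ → x *ᴿ y ≈ᴿ x′ *ᴿ y′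
  *-cong {x} {x′} {y} {y′} p q .close ε 0<ε = go (bounded₂ x y′)
    where
    go : ∃[ C ] (0ℚ ℚ.< C × Bound (seq x) C × Bound (seq y′) C) →
         Eventually (λ n → ℚ.∣ seq x n ℚ.* seq y n ℚ.- seq x′ n ℚ.* seq y′ n ∣ ℚ.< ε)
    go (C , 0<C , xC , y′C) with small C ε 0<C 0<ε
    ... | δ , 0<δ , eq = eventually-map
      (λ {n} ((a , b) , c , d) →
        ≡.subst (ℚ.∣ seq x n ℚ.* seq y n ℚ.- seq x′ n ℚ.* seq y′ n ∣ ℚ.<_) eq
          (near-* (seq x n) (seq x′ n) (seq y n) (seq y′ n) 0<C a b c d))
      (eventually-× (eventually-× xC y′C) (eventually-× (close p δ 0<δ) (close q δ 0<δ)))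

ℝ-commutativeRing : CommutativeRing 0ℓ 0ℓ
ℝ-commutativeRing = record
  { Carrier = ℝ
  ; _≈_ = _≈ᴿ_
  ; _+_ = _+ᴿ_
  ; _*_ = _*ᴿ_
  ; -_ = -ᴿ_
  ; 0# = ι 0ℚ
  ; 1# = ι 1ℚ
  ; isCommutativeRing = record
    { isRing = record
      { +-isAbelianGroup = record
        { isGroup = record
          { isMonoid = record
            { isSemigroup = record
              { isMagma = record
                { isEquivalence = record
                  { refl = pointwise (λ _ → ≡.refl)
                  ; sym = ≈-sym
                  ; trans = ≈-trans
                  }
                ; ∙-cong = +-cong
                }
              ; assoc = λ x y z → pointwise (λ n → ℚₚ.+-assoc (seq x n) (seq y n) (seq z n))
              }
            ; identity = (λ x → pointwise (λ n → ℚₚ.+-identityˡ (seq x n)))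
                       , (λ x → pointwise (λ n → ℚₚ.+-identityʳ (seq x n)))
            }
          ; inverse = (λ x → pointwise (λ n → ℚₚ.+-inverseˡ (seq x n)))
                    , (λ x → pointwise (λ n → ℚₚ.+-inverseʳ (seq x n)))
          ; ⁻¹-cong = neg-cong
          }
        ; comm = λ x y → pointwise (λ n → ℚₚ.+-comm (seq x n) (seq y n))
        }
      ; *-cong = *-cong
      ; *-assoc = λ x y z → pointwise (λ n → ℚₚ.*-assoc (seq x n) (seq y n) (seq z n))
      ; *-identity = (λ x → pointwise (λ n → ℚₚ.*-identityˡ (seq x n)))
                   , (λ x → pointwise (λ n → ℚₚ.*-identityʳ (seq x n)))
      ; distrib = (λ x y z → pointwise (λ n → ℚₚ.*-distribˡ-+ (seq x n) (seq y n) (seq z n)))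
                , (λ x y z → pointwise (λ n → ℚₚ.*-distribʳ-+ (seq x n) (seq y n) (seq z n)))
      }
    ; *-comm = λ x y → pointwise (λ n → ℚₚ.*-comm (seq x n) (seq y n))
    }
  }

module R = CommutativeRing ℝ-commutativeRing
open R public using (_≈_; _+_; _*_; -_; _-_; 0#; 1#)
open import Algebra.Properties.Semiring.Sum R.semiring public using (sum-syntax; sum⁺-syntax)
open import Algebra.Properties.Semiring.Exp R.semiring public using (_^_)

infix 4 _≤_

_≤_ : ℝ → ℝ → Set
_≤_ = _≤ᴿ_

fromℤ : ℤ → ℝ
fromℤ z = ι (z ℚ./ 1)

fromℕ : ℕ → ℝ
fromℕ n = fromℤ (+ n)

1/!_ : ℕ → ℝ
1/! n = ι ((+ 1 ℚ./ (n !)) {{n ℕₚ.!≢0}})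

-- Real division points a = point 0 ≤ … ≤ point size = b, with a real tag
-- in each subinterval; repeated points are allowed.
record TaggedPartition (a b : ℝ) : Set where
  field
    size      : ℕ
    point     : Fin (suc size) → ℝ
    tag       : Fin size → ℝ
    start     : point zero ≈ a
    end       : point (Fin.fromℕ size) ≈ b
    point≤tag : ∀ i → point (inject₁ i) ≤ tag i
    tag≤point : ∀ i → tag i ≤ point (suc i)

  width : Fin size → ℝ
  width i = point (suc i) - point (inject₁ i)

  riemannSum : (ℝ → ℝ) → ℝ
  riemannSum f = ∑[ i < size ] (f (tag i) * width i)

open TaggedPartition public

-- Riemann sums tend to I as the mesh tends to 0.  Rational ε and δ are
-- cofinal among the positive reals.
IsIntegral : (a b : ℝ) → (ℝ → ℝ) → ℝ → Set
IsIntegral a b f I =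
  ∀ ε → 0ℚ ℚ.< ε → ∃[ δ ] (0ℚ ℚ.< δ ×
    ((P : TaggedPartition a b) → (∀ i → width P i ≤ ι δ) →
      ∣ riemannSum P f - I ∣ ≤ ι ε))

-- A formal power series is the sequence of its coefficients.
Series : Set
Series = ℕ → ℝ

infix 4 _≋_

_≋_ : Series → Series → Set
f ≋ g = ∀ n → f n ≈ g n

1ₛ : Series
1ₛ zero    = 1#
1ₛ (suc _) = 0#

infixl 6 _-ₛ_
infixl 7 _*ₛ_ _·_
infixr 8 _^ₛ_

_-ₛ_ : Series → Series → Series
(f -ₛ g) n = f n - g n

_·_ : ℝ → Series → Series
(c · f) n = c * f n

_*ₛ_ : Series → Series → Series
(f *ₛ g) n = ∑[ i ≤ n ] (f (toℕ i) * g (n ∸ toℕ i))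

_^ₛ_ : Series → ℕ → Series
f ^ₛ zero  = 1ₛ
f ^ₛ suc k = f *ₛ (f ^ₛ k)

-- Σₖ aₖ gᵏ.  As g has no constant term, gᵏ contributes to the coefficient
-- of tⁿ only for k ≤ n.
compose : (a g : Series) → g 0 ≈ 0# → Series
compose a g _ n = ∑[ k ≤ n ] (a (toℕ k) * (g ^ₛ toℕ k) n)

egf : (ℕ → ℝ) → Series
egf a n = a n * 1/! n

IsCoefficientwiseIntegral : (a b : ℝ) → (ℝ → Series) → Series → Set
IsCoefficientwiseIntegral a b F G = ∀ n → IsIntegral a b (λ x → F x n) (G n)

-- (x)_{n,μ} and ⟨a⟩ₖ.  The parameter λ is written ƛ, as λ is reserved.
⦅_⦆[_,_] : ℝ → ℕ → ℝ → ℝ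
⦅ x ⦆[ zero  , μ ] = 1#
⦅ x ⦆[ suc n , μ ] = ⦅ x ⦆[ n , μ ] * (x - fromℕ n * μ)

⟨_⟩[_] : ℝ → ℕ → ℝ
⟨ a ⟩[ zero  ] = 1#
⟨ a ⟩[ suc k ] = ⟨ a ⟩[ k ] * (a + fromℕ k)

binom : ℝ → ℕ → ℝ
binom α k = ⦅ α ⦆[ k , 1# ] * 1/! k

e[_] : ℝ → Series
e[ ƛ ] = egf (λ n → ⦅ 1# ⦆[ n , ƛ ])

1-e[_] : ℝ → Series
1-e[ ƛ ] = 1ₛ -ₛ e[ ƛ ]

1-e-constant : ∀ ƛ → 1-e[ ƛ ] 0 ≈ 0#
1-e-constant ƛ = pointwise (λ _ → ≡.refl)

Inverse : ℝ → Set
Inverse x = Invertible _≈_ 1# _*_ x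

-- The coefficients divide by ⟨c⟩ₖ, hence the last argument.
₂F₁ : (a b c : ℝ) → (∀ k → Inverse ⟨ c ⟩[ k ]) → Series
₂F₁ a b c c⁻¹ k = ⟨ a ⟩[ k ] * ⟨ b ⟩[ k ] * proj₁ (c⁻¹ k) * 1/! k

private
  *-inverse : ∀ {x y} → Inverse x → Inverse y → Inverse (x * y)
  *-inverse {x} {y} (u , ux , xu) (v , vy , yv) =
    u * v , left , R.trans (R.*-comm _ _) left
    where
    open import Relation.Binary.Reasoning.Setoid R.setoid
    open import Algebra.Properties.CommutativeSemigroup R.*-commutativeSemigroup
      using (interchange)
    left : u * v * (x * y) ≈ 1#
    left = begin
      u * v * (x * y)   ≈⟨ interchange u v x y ⟩
      u * x * (v * y)   ≈⟨ R.*-cong ux vy ⟩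
      1# * 1#           ≈⟨ R.*-identityˡ 1# ⟩
      1#                ∎

  ι-inverse : ∀ q → .{{ℚ.NonZero q}} → Inverse (ι q)
  ι-inverse q = ι (ℚ.1/ q) , pointwise (λ _ → ℚₚ.*-inverseˡ q)
                           , pointwise (λ _ → ℚₚ.*-inverseʳ q)

⟨⟩-inverse : ∀ z → .{{ℤ.Positive z}} → ∀ k → Inverse ⟨ fromℤ z ⟩[ k ]
⟨⟩-inverse z zero = ι-inverse 1ℚ
⟨⟩-inverse z@(ℤ.+[1+ m ]) (suc k) = *-inverse (⟨⟩-inverse z k)
  (let u , ul , ur = ι-inverse q in
   u , R.trans (R.*-congˡ sum≈) ul , R.trans (R.*-congʳ sum≈) ur)
  where
  q = (z ℚ./ 1) ℚ.+ (+ k ℚ./ 1)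
  instance
    _ = ℚₚ.normalize-pos (suc m) 1
    _ = ℚₚ.normalize-nonNeg k 1
    _ = ℚₚ.pos+nonNeg⇒pos (z ℚ./ 1) (+ k ℚ./ 1)
    q-nz = ℚₚ.pos⇒nonZero q
  sum≈ : fromℤ z + fromℕ k ≈ ι q
  sum≈ = pointwise (λ _ → ≡.refl)

p+2-positive : ∀ p → -1ℤ ℤ.≤ p → ℤ.Positive (p ℤ.+ + 2)
p+2-positive p -1≤p = ℤ.positive (ℤₚ.<-≤-trans (ℤ.+<+ ℕ.z<s) (ℤₚ.+-monoˡ-≤ (+ 2) -1≤p))

-- ₂F₁(1 - ƛ, 1; p + 2; 1 - e_ƛ(t)).
F[_,_] : (ƛ : ℝ) (p : ℤ) → -1ℤ ℤ.≤ p → Series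
F[ ƛ , p ] -1≤p = compose
  (₂F₁ (1# - ƛ) 1# (fromℤ (p ℤ.+ + 2)) (⟨⟩-inverse (p ℤ.+ + 2) {{p+2-positive p -1≤p}}))
  1-e[ ƛ ] (1-e-constant ƛ)

-- The defining identity Σ βₙ tⁿ/n! = F, solved for βₙ; see β-generating.
β[_,_] : (ƛ : ℝ) (p : ℤ) → -1ℤ ℤ.≤ p → ℕ → ℝ
β[ ƛ , p ] -1≤p n = fromℕ (n !) * F[ ƛ , p ] -1≤p n

β-generating : ∀ ƛ p (-1≤p : -1ℤ ℤ.≤ p) → F[ ƛ , p ] -1≤p ≋ egf (β[ ƛ , p ] -1≤p)
β-generating ƛ p -1≤p n = begin
  f                              ≈⟨ R.*-identityʳ f ⟨
  f * 1#                         ≈⟨ R.*-congˡ (pointwise (λ _ → cancel (n !) {{n ℕₚ.!≢0}})) ⟨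
  f * (fromℕ (n !) * 1/! n)     ≈⟨ R.*-assoc f (fromℕ (n !)) (1/! n) ⟨
  f * fromℕ (n !) * 1/! n       ≈⟨ R.*-congʳ (R.*-comm f (fromℕ (n !))) ⟩
  fromℕ (n !) * f * 1/! n       ∎
  where
  open import Relation.Binary.Reasoning.Setoid R.setoid
  f = F[ ƛ , p ] -1≤p n
  cancel : ∀ m → .{{_ : ℕ.NonZero m}} → (+ m ℚ./ 1) ℚ.* (+ 1 ℚ./ m) ≡ 1ℚ
  cancel m@(suc _) = ℚₚ.toℚᵘ-injective (ℚᵘₚ.≃-trans
    (ℚₚ.toℚᵘ-homo-* (+ m ℚ./ 1) (+ 1 ℚ./ m))
    (ℚᵘₚ.≃-trans
      (ℚᵘₚ.*-cong (ℚₚ.toℚᵘ-fromℚᵘ (ℚᵘ.mkℚᵘ (+ m) 0))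
                  (ℚₚ.toℚᵘ-fromℚᵘ (ℚᵘ.mkℚᵘ (+ 1) (ℕ.pred m))))
      (ℚᵘₚ.*-inverseʳ (ℚᵘ.mkℚᵘ (+ m) 0))))

-- (1 - x(1 - e_ƛ(t)))^(ƛ - 1), expanded by the binomial series.
kernel : ℝ → ℝ → Series
kernel ƛ x = compose (λ k → binom (ƛ - 1#) k * (- x) ^ k) 1-e[ ƛ ] (1-e-constant ƛ)

integrand : ℝ → ℕ → ℝ → Series
integrand ƛ p x = (1# - x) ^ p · kernel ƛ x

{-# OPTIONS --safe #-}
module Submission where

-- The coefficient of tⁿ in the integrand is a linear combination of the
-- polynomials xᵏ(1-x)ᵖ, because (ƛ-1)ₖ(-x)ᵏ = ⟨1-ƛ⟩ₖ xᵏ.  Repeated integration by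
-- parts gives (p+1) ∫₀¹ xᵏ(1-x)ᵖ dx = ⟨1⟩ₖ / ⟨p+2⟩ₖ, which turns this combination
-- into the hypergeometric coefficients.  The integrals exist by the fundamental
-- theorem: if |f(t)(y-x) - (F(y)-F(x))| ≤ C(y-x)² for x ≤ t ≤ y, then the errors in
-- a Riemann sum of mesh δ add up to at most Cδ.

open import Defs
open import Algebra.Bundles using (RawRing)
open import Algebra.Properties.Semiring.Exp R.semiring using (^-congˡ)
open import Algebra.Properties.Semiring.Sum R.semiring
  using (sum-cong-≋; ∑-distrib-+; *-distribˡ-sum)
import Algebra.Solver.Ring as RingSolver
open import Algebra.Solver.Ring.AlmostCommutativeRing
  using (fromCommutativeRing; _-Raw-AlmostCommutative⟶_)
open import Data.Fin.Base as Fin using (Fin; zero; suc; inject₁; toℕ)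
open import Data.Fin.Induction using (<-weakInduction; >-weakInduction)
open import Data.Integer.Base as ℤ using (+_; -≤+)
import Data.Integer.Properties as ℤₚ
open import Data.Maybe.Base as Maybe using (Maybe)
open import Data.Nat.Base as ℕ using (ℕ; zero; suc; _⊔_)
open import Data.Nat.Coprimality as Coprime using (1-coprimeTo)
import Data.Nat.Properties as ℕₚ
open import Data.Product.Base using (∃-syntax; _×_; _,_; proj₁; proj₂)
open import Data.Rational.Base as ℚ using (ℚ; 0ℚ; 1ℚ; ½)
import Data.Rational.Properties as ℚₚ
open import Data.Rational.Solver using (module +-*-Solver)
open import Data.Sum.Base using ([_,_]′)
open import Level using (0ℓ)
open import Relation.Binary.Bundles using (Poset)
import Relation.Binary.Reasoning.PartialOrder as PosetReasoning
open import Relation.Binary.PropositionalEquality.Core as ≡ using (_≡_)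
open import Relation.Nullary.Decidable.Core using (dec⇒maybe)

private
  module ℚ-Solver = +-*-Solver

-- Order, absolute value and rational bounds for Cauchy reals

half-pos : ∀ {ε} → 0ℚ ℚ.< ε → 0ℚ ℚ.< ½ ℚ.* ε
half-pos {ε} 0<ε = ℚₚ.positive⁻¹ (½ ℚ.* ε)
  {{ℚₚ.pos*pos⇒pos ½ ε {{ℚ.positive 0<ε}}}}

half< : ∀ {ε} → 0ℚ ℚ.< ε → ½ ℚ.* ε ℚ.< ε
half< {ε} 0<ε = ≡.subst₂ ℚ._<_ (ℚₚ.+-identityʳ (½ ℚ.* ε))
  (solve 1 (λ e → con ½ :* e :+ con ½ :* e := e) ≡.refl ε)
  (ℚₚ.+-monoʳ-< (½ ℚ.* ε) (half-pos 0<ε))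
  where open ℚ-Solver

p≤p+ε : ∀ p {ε} → 0ℚ ℚ.< ε → p ℚ.≤ p ℚ.+ ε
p≤p+ε p {ε} 0<ε = ≡.subst (ℚ._≤ p ℚ.+ ε) (ℚₚ.+-identityʳ p) (ℚₚ.+-monoʳ-≤ p (ℚₚ.<⇒≤ 0<ε))

p≤∣p∣ : ∀ p → p ℚ.≤ ℚ.∣ p ∣
p≤∣p∣ p = [ (λ 0≤p → ℚₚ.≤-reflexive (≡.sym (ℚₚ.0≤p⇒∣p∣≡p 0≤p)))
          , (λ p≤0 → ℚₚ.≤-trans p≤0 (ℚₚ.0≤∣p∣ p)) ]′ (ℚₚ.≤-total 0ℚ p)

∣p∣≤ : ∀ {p q} → p ℚ.≤ q → ℚ.- p ℚ.≤ q → ℚ.∣ p ∣ ℚ.≤ q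
∣p∣≤ {p} {q} p≤q -p≤q = [ (λ e → ≡.subst (ℚ._≤ q) (≡.sym e) p≤q)
                        , (λ e → ≡.subst (ℚ._≤ q) (≡.sym e) -p≤q) ]′ (ℚₚ.∣p∣≡p∨∣p∣≡-p p)

eventually₂ : ∀ {P Q S : ℕ → Set} → (∀ {n} → P n → Q n → S n) →
              Eventually P → Eventually Q → Eventually S
eventually₂ f (M , p) (N , q) = M ⊔ N , λ n M⊔N≤n →
  f (p n (ℕₚ.m⊔n≤o⇒m≤o M N M⊔N≤n)) (q n (ℕₚ.m⊔n≤o⇒n≤o M N M⊔N≤n))

eventually₁ : ∀ {P Q : ℕ → Set} → (∀ {n} → P n → Q n) → Eventually P → Eventually Q
eventually₁ f (N , p) = N , λ n N≤n → f (p n N≤n)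

pointwise-≤ : ∀ {x y} → (∀ n → seq x n ℚ.≤ seq y n) → x ≤ y
pointwise-≤ {x} {y} x≤y .below ε 0<ε = 0 , λ n _ →
  ℚₚ.≤-trans (x≤y n) (p≤p+ε (seq y n) 0<ε)

≤-reflexive : ∀ {x y} → x ≈ y → x ≤ y
≤-reflexive {x} {y} x≈y .below ε 0<ε = eventually₁
  (λ {n} d → ≡.subst (ℚ._≤ seq y n ℚ.+ ε)
    (solve 2 (λ p q → q :+ (p :- q) := p) ≡.refl (seq x n) (seq y n))
    (ℚₚ.+-monoʳ-≤ (seq y n) (ℚₚ.≤-trans (p≤∣p∣ (seq x n ℚ.- seq y n)) (ℚₚ.<⇒≤ d))))
  (close x≈y ε 0<ε)
  where open ℚ-Solver

≤-trans : ∀ {x y z} → x ≤ y → y ≤ z → x ≤ z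
≤-trans {x} {y} {z} x≤y y≤z .below ε 0<ε = eventually₂
  (λ {n} a b → ≡.subst (seq x n ℚ.≤_)
    (solve 2 (λ r e → (r :+ con ½ :* e) :+ con ½ :* e := r :+ e) ≡.refl (seq z n) ε)
    (ℚₚ.≤-trans a (ℚₚ.+-monoˡ-≤ (½ ℚ.* ε) b)))
  (below x≤y _ (half-pos 0<ε)) (below y≤z _ (half-pos 0<ε))
  where open ℚ-Solver

≤-antisym : ∀ {x y} → x ≤ y → y ≤ x → x ≈ y
≤-antisym {x} {y} x≤y y≤x .close ε 0<ε = eventually₂
  -- The field `close` asks for a strict bound, so both inequalities are taken with tolerance ε/2,
  -- which is strictly below ε.
  (λ {n} a b → ℚₚ.≤-<-trans (∣p∣≤ (diff a)
    (≡.subst (ℚ._≤ ½ ℚ.* ε)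
      (solve 2 (λ p q → q :- p := :- (p :- q)) ≡.refl (seq x n) (seq y n)) (diff b)))
    (half< 0<ε))
  (below x≤y _ (half-pos 0<ε)) (below y≤x _ (half-pos 0<ε))
  where
  open ℚ-Solver
  diff : ∀ {p q δ} → p ℚ.≤ q ℚ.+ δ → p ℚ.- q ℚ.≤ δ
  diff {p} {q} {δ} p≤q+δ = ≡.subst (p ℚ.- q ℚ.≤_)
    (solve 2 (λ s t → (s :+ t) :- s := t) ≡.refl q δ) (ℚₚ.+-monoˡ-≤ (ℚ.- q) p≤q+δ)

ℝ-poset : Poset 0ℓ 0ℓ 0ℓ
ℝ-poset = record
  { _≤_ = _≤_
  ; isPartialOrder = record
    { isPreorder = record
      { isEquivalence = R.isEquivalence
      ; reflexive = ≤-reflexive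
      ; trans = ≤-trans
      }
    ; antisym = ≤-antisym
    }
  }

module ≤-Reasoning = PosetReasoning ℝ-poset
open ≤-Reasoning hiding (start)

≤-refl : ∀ {x} → x ≤ x
≤-refl = ≤-reflexive R.refl

+-mono-≤ : ∀ {x x′ y y′} → x ≤ x′ → y ≤ y′ → x + y ≤ x′ + y′
+-mono-≤ {x} {x′} {y} {y′} x≤x′ y≤y′ .below ε 0<ε = eventually₂
  (λ {n} a b → ≡.subst (seq x n ℚ.+ seq y n ℚ.≤_)
    (solve 3 (λ p q e → (p :+ con ½ :* e) :+ (q :+ con ½ :* e) := (p :+ q) :+ e)
      ≡.refl (seq x′ n) (seq y′ n) ε)
    (ℚₚ.+-mono-≤ a b))
  (below x≤x′ _ (half-pos 0<ε)) (below y≤y′ _ (half-pos 0<ε))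
  where open ℚ-Solver

∣∣-cong : ∀ {x y} → x ≈ y → ∣ x ∣ ≈ ∣ y ∣
∣∣-cong {x} {y} x≈y .close ε 0<ε = eventually₁
  (λ {n} d → ℚₚ.≤-<-trans (∣p∣≤ (diff (seq x n) (seq y n))
    (≡.subst₂ ℚ._≤_
      (solve 2 (λ p q → q :- p := :- (p :- q)) ≡.refl ℚ.∣ seq x n ∣ ℚ.∣ seq y n ∣)
      (≡.trans (≡.sym (ℚₚ.∣-p∣≡∣p∣ (seq y n ℚ.- seq x n)))
        (≡.cong ℚ.∣_∣ (solve 2 (λ p q → :- (q :- p) := p :- q) ≡.refl (seq x n) (seq y n))))
      (diff (seq y n) (seq x n)))) d)
  (close x≈y ε 0<ε)
  where
  open ℚ-Solver
  diff : ∀ p q → ℚ.∣ p ∣ ℚ.- ℚ.∣ q ∣ ℚ.≤ ℚ.∣ p ℚ.- q ∣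
  diff p q = ≡.subst₂ ℚ._≤_
    (≡.cong (λ s → ℚ.∣ s ∣ ℚ.- ℚ.∣ q ∣) (solve 2 (λ p q → (p :- q) :+ q := p) ≡.refl p q))
    (solve 2 (λ s t → (s :+ t) :- t := s) ≡.refl ℚ.∣ p ℚ.- q ∣ ℚ.∣ q ∣)
    (ℚₚ.+-monoˡ-≤ (ℚ.- ℚ.∣ q ∣) (ℚₚ.∣p+q∣≤∣p∣+∣q∣ (p ℚ.- q) q))

0≤∣x∣ : ∀ x → 0# ≤ ∣ x ∣
0≤∣x∣ x = pointwise-≤ λ n → ℚₚ.0≤∣p∣ (seq x n)

∣x+y∣≤∣x∣+∣y∣ : ∀ x y → ∣ x + y ∣ ≤ ∣ x ∣ + ∣ y ∣
∣x+y∣≤∣x∣+∣y∣ x y = pointwise-≤ λ n → ℚₚ.∣p+q∣≤∣p∣+∣q∣ (seq x n) (seq y n)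

∣x*y∣≈∣x∣*∣y∣ : ∀ x y → ∣ x * y ∣ ≈ ∣ x ∣ * ∣ y ∣
∣x*y∣≈∣x∣*∣y∣ x y = pointwise λ n → ℚₚ.∣p*q∣≡∣p∣*∣q∣ (seq x n) (seq y n)

∣-x∣≈∣x∣ : ∀ x → ∣ - x ∣ ≈ ∣ x ∣
∣-x∣≈∣x∣ x = pointwise λ n → ℚₚ.∣-p∣≡∣p∣ (seq x n)

0≤x⇒∣x∣≈x : ∀ {x} → 0# ≤ x → ∣ x ∣ ≈ x
0≤x⇒∣x∣≈x {x} 0≤x = ≤-antisym ∣x∣≤x (pointwise-≤ λ n → p≤∣p∣ (seq x n))
  where
  open ℚ-Solver
  ∣x∣≤x : ∣ x ∣ ≤ x
  ∣x∣≤x .below ε 0<ε = eventually₁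
    -- A nonnegative real may have negative terms. With tolerance ε/2, `0≤x` gives 0 ≤ xₙ + ε/2;
    -- doubling it yields -xₙ ≤ xₙ + ε.
    (λ {n} a → ∣p∣≤ (p≤p+ε (seq x n) 0<ε)
      (≡.subst₂ ℚ._≤_ (solve 1 (λ p → :- p :+ (con 0ℚ :+ con 0ℚ) := :- p) ≡.refl (seq x n))
        (solve 2 (λ p e → :- p :+ ((p :+ con ½ :* e) :+ (p :+ con ½ :* e)) := p :+ e)
          ≡.refl (seq x n) ε)
        (ℚₚ.+-monoʳ-≤ (ℚ.- seq x n) (ℚₚ.+-mono-≤ a a))))
    (below 0≤x _ (half-pos 0<ε))

-- The terms from some index `N` on stay within 1 of the `N`-th one. A positive rational bound can
-- be inverted, so a mesh ε/K can be formed later from a real error constant.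
upper-bound : ∀ x → ∃[ K ] (0ℚ ℚ.< K × x ≤ ι K)
upper-bound x = go (cauchy x 1ℚ (ℚₚ.positive⁻¹ 1ℚ))
  where
  open ℚ-Solver
  go : ∃[ N ] (∀ m n → N ℕ.≤ m → N ℕ.≤ n → ℚ.∣ seq x m ℚ.- seq x n ∣ ℚ.< 1ℚ) →
       ∃[ K ] (0ℚ ℚ.< K × x ≤ ι K)
  go (N , near) = K , ℚₚ.<-≤-trans (ℚₚ.positive⁻¹ 1ℚ) 1≤K , mk≤ λ ε 0<ε → N , λ n N≤n →
    ℚₚ.≤-trans (bound n N≤n) (p≤p+ε K 0<ε)
    where
    K = 1ℚ ℚ.+ ℚ.∣ seq x N ∣
    1≤K : 1ℚ ℚ.≤ K
    1≤K = ≡.subst (ℚ._≤ K) (ℚₚ.+-identityʳ 1ℚ) (ℚₚ.+-monoʳ-≤ 1ℚ (ℚₚ.0≤∣p∣ (seq x N)))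
    bound : ∀ n → N ℕ.≤ n → seq x n ℚ.≤ K
    bound n N≤n = ≡.subst (ℚ._≤ K)
      (solve 2 (λ p q → (p :- q) :+ q := p) ≡.refl (seq x n) (seq x N))
      (ℚₚ.+-mono-≤
        (ℚₚ.≤-trans (p≤∣p∣ (seq x n ℚ.- seq x N)) (ℚₚ.<⇒≤ (near n N N≤n ℕₚ.≤-refl)))
        (p≤∣p∣ (seq x N)))

-- The ring solver needs a decidable equality, which ℝ lacks: its coefficients are rational.
ℚ-rawRing : RawRing 0ℓ 0ℓ
ℚ-rawRing = record
  { Carrier = ℚ ; _≈_ = _≡_ ; _+_ = ℚ._+_ ; _*_ = ℚ._*_ ; -_ = ℚ.-_ ; 0# = 0ℚ ; 1# = 1ℚ }

ι-morphism : ℚ-rawRing -Raw-AlmostCommutative⟶ fromCommutativeRing ℝ-commutativeRing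
ι-morphism = record
  { ⟦_⟧ = ι
  ; +-homo = λ _ _ → pointwise λ _ → ≡.refl
  ; *-homo = λ _ _ → pointwise λ _ → ≡.refl
  ; -‿homo = λ _ → pointwise λ _ → ≡.refl
  ; 0-homo = R.refl
  ; 1-homo = R.refl
  }

ι-≟ : ∀ p q → Maybe (ι p ≈ ι q)
ι-≟ p q = Maybe.map (λ { ≡.refl → R.refl }) (dec⇒maybe (p ℚₚ.≟ q))

open RingSolver ℚ-rawRing (fromCommutativeRing ℝ-commutativeRing) ι-morphism ι-≟
  using (solve; _:=_; _:+_; _:*_; _:-_; :-_; con)

-- Inequalities in the ordered ring

x≤y⇒0≤y-x : ∀ {x y} → x ≤ y → 0# ≤ y - x
x≤y⇒0≤y-x {x} {y} x≤y = begin
  0#    ≈⟨ R.-‿inverseʳ x ⟨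
  x - x ≤⟨ +-mono-≤ x≤y ≤-refl ⟩
  y - x ∎

0≤y-x⇒x≤y : ∀ {x y} → 0# ≤ y - x → x ≤ y
0≤y-x⇒x≤y {x} {y} 0≤y-x = begin
  x           ≈⟨ R.+-identityʳ x ⟨
  x + 0#      ≤⟨ +-mono-≤ ≤-refl 0≤y-x ⟩
  x + (y - x) ≈⟨ solve 2 (λ x y → x :+ (y :- x) := y) R.refl x y ⟩
  y           ∎

-- Since `0#` ≤ x does not hold termwise, multiplying the terms gives nothing directly. The detour
-- through absolute values, which are termwise nonnegative and multiplicative, avoids this.
*-nonNeg : ∀ {x y} → 0# ≤ x → 0# ≤ y → 0# ≤ x * y
*-nonNeg {x} {y} 0≤x 0≤y = begin
  0#            ≤⟨ 0≤∣x∣ (x * y) ⟩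
  ∣ x * y ∣     ≈⟨ ∣x*y∣≈∣x∣*∣y∣ x y ⟩
  ∣ x ∣ * ∣ y ∣ ≈⟨ R.*-cong (0≤x⇒∣x∣≈x 0≤x) (0≤x⇒∣x∣≈x 0≤y) ⟩
  x * y         ∎

*-monoˡ-≤ : ∀ {x y z} → 0# ≤ z → x ≤ y → z * x ≤ z * y
*-monoˡ-≤ {x} {y} {z} 0≤z x≤y = 0≤y-x⇒x≤y (begin
  0#            ≤⟨ *-nonNeg 0≤z (x≤y⇒0≤y-x x≤y) ⟩
  z * (y - x)   ≈⟨ solve 3 (λ x y z → z :* (y :- x) := z :* y :- z :* x) R.refl x y z ⟩
  z * y - z * x ∎)

*-monoʳ-≤ : ∀ {x y z} → 0# ≤ z → x ≤ y → x * z ≤ y * z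
*-monoʳ-≤ {x} {y} {z} 0≤z x≤y = begin
  x * z ≈⟨ R.*-comm x z ⟩
  z * x ≤⟨ *-monoˡ-≤ 0≤z x≤y ⟩
  z * y ≈⟨ R.*-comm z y ⟩
  y * z ∎

∣+∣≤ : ∀ {x y a b} → ∣ x ∣ ≤ a → ∣ y ∣ ≤ b → ∣ x + y ∣ ≤ a + b
∣+∣≤ {x} {y} x≤a y≤b = ≤-trans (∣x+y∣≤∣x∣+∣y∣ x y) (+-mono-≤ x≤a y≤b)

∣*∣≤ : ∀ {x y a b} → ∣ x ∣ ≤ a → ∣ y ∣ ≤ b → ∣ x * y ∣ ≤ a * b
∣*∣≤ {x} {y} {a} {b} x≤a y≤b = begin
  ∣ x * y ∣     ≈⟨ ∣x*y∣≈∣x∣*∣y∣ x y ⟩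
  ∣ x ∣ * ∣ y ∣ ≤⟨ *-monoʳ-≤ (0≤∣x∣ y) x≤a ⟩
  a * ∣ y ∣     ≤⟨ *-monoˡ-≤ (≤-trans (0≤∣x∣ x) x≤a) y≤b ⟩
  a * b         ∎

-- Uniform derivatives on [0,1] and their calculus

square : ℝ → ℝ
square w = w * w

-- Uniformly on [0,1]; f is evaluated at an arbitrary tag t ∈ [x,y] so that the
-- bound applies directly to the terms of a tagged Riemann sum.
record HasDerivative (F f : ℝ → ℝ) : Set where
  field
    cong  : ∀ {x y} → x ≈ y → F x ≈ F y
    value : ∃[ C ] (∀ {x} → 0# ≤ x → x ≤ 1# → ∣ F x ∣ ≤ C)
    slope : ∃[ C ] (∀ {x} → 0# ≤ x → x ≤ 1# → ∣ f x ∣ ≤ C)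
    error : ∃[ C ] (∀ {x t y} → 0# ≤ x → x ≤ t → t ≤ y → y ≤ 1# →
              ∣ f t * (y - x) - (F y - F x) ∣ ≤ C * square (y - x))

open HasDerivative

HasDerivative-resp : ∀ {F G f g} → (∀ x → F x ≈ G x) → (∀ x → f x ≈ g x) →
                     HasDerivative F f → HasDerivative G g
HasDerivative-resp F≈G f≈g D .cong x≈y = R.trans (R.sym (F≈G _)) (R.trans (D .cong x≈y) (F≈G _))
HasDerivative-resp F≈G f≈g D .value = let C , F≤C = D .value in
  C , λ 0≤x x≤1 → ≤-trans (≤-reflexive (∣∣-cong (R.sym (F≈G _)))) (F≤C 0≤x x≤1)
HasDerivative-resp F≈G f≈g D .slope = let C , f≤C = D .slope in
  C , λ 0≤x x≤1 → ≤-trans (≤-reflexive (∣∣-cong (R.sym (f≈g _)))) (f≤C 0≤x x≤1)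
HasDerivative-resp F≈G f≈g D .error = let C , e≤C = D .error in
  C , λ 0≤x x≤t t≤y y≤1 → ≤-trans
    (≤-reflexive (∣∣-cong (R.sym (R.+-cong (R.*-congʳ (f≈g _))
      (R.-‿cong (R.+-cong (F≈G _) (R.-‿cong (F≈G _))))))))
    (e≤C 0≤x x≤t t≤y y≤1)

-- Serves the constant and identity functions: their error vanishes identically, so the error
-- constant can be 0.
∣0∣≤0* : ∀ {x} y → x ≈ 0# → ∣ x ∣ ≤ 0# * y
∣0∣≤0* {x} y x≈0 = begin
  ∣ x ∣  ≈⟨ ∣∣-cong x≈0 ⟩
  ∣ 0# ∣ ≈⟨ 0≤x⇒∣x∣≈x ≤-refl ⟩
  0#     ≈⟨ R.zeroˡ y ⟨
  0# * y ∎

const-derivative : ∀ c → HasDerivative (λ _ → c) (λ _ → 0#)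
const-derivative c .cong _ = R.refl
const-derivative c .value = ∣ c ∣ , λ _ _ → ≤-refl
const-derivative c .slope = ∣ 0# ∣ , λ _ _ → ≤-refl
const-derivative c .error = 0# , λ {x} {t} {y} _ _ _ _ → ∣0∣≤0* _
  (solve 3 (λ c x y → con 0ℚ :* (y :- x) :- (c :- c) := con 0ℚ) R.refl c x y)

id-derivative : HasDerivative (λ x → x) (λ _ → 1#)
id-derivative .cong x≈y = x≈y
id-derivative .value = 1# , λ 0≤x x≤1 → ≤-trans (≤-reflexive (0≤x⇒∣x∣≈x 0≤x)) x≤1
id-derivative .slope = ∣ 1# ∣ , λ _ _ → ≤-refl
id-derivative .error = 0# , λ {x} {t} {y} _ _ _ _ → ∣0∣≤0* _
  (solve 2 (λ x y → con 1ℚ :* (y :- x) :- (y :- x) := con 0ℚ) R.refl x y)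

+-derivative : ∀ {F f G g} → HasDerivative F f → HasDerivative G g →
               HasDerivative (λ x → F x + G x) (λ x → f x + g x)
+-derivative D E .cong x≈y = R.+-cong (D .cong x≈y) (E .cong x≈y)
+-derivative D E .value = let C , F≤C = D .value ; B , G≤B = E .value in
  C + B , λ 0≤x x≤1 → ∣+∣≤ (F≤C 0≤x x≤1) (G≤B 0≤x x≤1)
+-derivative D E .slope = let C , f≤C = D .slope ; B , g≤B = E .slope in
  C + B , λ 0≤x x≤1 → ∣+∣≤ (f≤C 0≤x x≤1) (g≤B 0≤x x≤1)
+-derivative {F} {f} {G} {g} D E .error = let C , e≤C = D .error ; B , e≤B = E .error in
  C + B , λ {x} {t} {y} 0≤x x≤t t≤y y≤1 → begin
    ∣ (f t + g t) * (y - x) - (F y + G y - (F x + G x)) ∣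
      ≈⟨ ∣∣-cong (solve 7 (λ f g w Fy Gy Fx Gx →
           (f :+ g) :* w :- (Fy :+ Gy :- (Fx :+ Gx)) :=
           (f :* w :- (Fy :- Fx)) :+ (g :* w :- (Gy :- Gx)))
           R.refl (f t) (g t) (y - x) (F y) (G y) (F x) (G x)) ⟩
    ∣ (f t * (y - x) - (F y - F x)) + (g t * (y - x) - (G y - G x)) ∣
      ≤⟨ ∣+∣≤ (e≤C 0≤x x≤t t≤y y≤1) (e≤B 0≤x x≤t t≤y y≤1) ⟩
    C * square (y - x) + B * square (y - x)
      ≈⟨ R.distribʳ (square (y - x)) C B ⟨
    (C + B) * square (y - x) ∎

0≤1 : 0# ≤ 1#
0≤1 = pointwise-≤ λ _ → ℚₚ.<⇒≤ (ℚₚ.positive⁻¹ 1ℚ)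

-- Evaluating the error bound at x = t = 0 and y = 1, where the squared width is 1, bounds an
-- absolute value by the constant itself.
error-nonNeg : ∀ {F f} (D : HasDerivative F f) → 0# ≤ D .error .proj₁
error-nonNeg {F} {f} D = let C , e≤C = D .error in begin
  0#
    ≤⟨ 0≤∣x∣ _ ⟩
  ∣ f 0# * (1# - 0#) - (F 1# - F 0#) ∣
    ≤⟨ e≤C ≤-refl ≤-refl 0≤1 ≤-refl ⟩
  C * square (1# - 0#)
    ≈⟨ solve 1 (λ C → C :* ((con 1ℚ :- con 0ℚ) :* (con 1ℚ :- con 0ℚ)) := C) R.refl C ⟩
  C ∎

Lipschitz : (ℝ → ℝ) → Set
Lipschitz F = ∃[ L ] (0# ≤ L ×
  (∀ {x y} → 0# ≤ x → x ≤ y → y ≤ 1# → ∣ F y - F x ∣ ≤ L * (y - x)))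

-- With the tag at the left endpoint, F(y) - F(x) is f(x)(y-x) minus the error. The error is at most
-- C(y-x)², hence at most C(y-x), because y-x ≤ 1 inside [0,1].
lipschitz : ∀ {F f} → HasDerivative F f → Lipschitz F
lipschitz {F} {f} D = let C , e≤C = D .error ; B , f≤B = D .slope
                          0≤B = ≤-trans (0≤∣x∣ (f 0#)) (f≤B ≤-refl 0≤1)
                          0≤C = error-nonNeg D
  in B + C , ≤-trans (≤-reflexive (R.sym (R.+-identityʳ 0#))) (+-mono-≤ 0≤B 0≤C) ,
  λ {x} {y} 0≤x x≤y y≤1 →
    let 0≤w = x≤y⇒0≤y-x x≤y
        w≤1 = begin
          y - x   ≤⟨ +-mono-≤ y≤1 (0≤y-x⇒x≤y (≤-trans 0≤x (≤-reflexive
                       (solve 1 (λ x → x := con 0ℚ :- (:- x)) R.refl x)))) ⟩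
          1# + 0# ≈⟨ R.+-identityʳ 1# ⟩
          1#      ∎
    in begin
    ∣ F y - F x ∣
      ≈⟨ ∣∣-cong (solve 2 (λ a d → d := a :+ :- (a :- d)) R.refl (f x * (y - x)) (F y - F x)) ⟩
    ∣ f x * (y - x) + - (f x * (y - x) - (F y - F x)) ∣
      ≤⟨ ∣+∣≤ (∣*∣≤ (f≤B 0≤x (≤-trans x≤y y≤1)) (≤-reflexive (0≤x⇒∣x∣≈x 0≤w)))
              (≤-trans (≤-reflexive (∣-x∣≈∣x∣ _)) (e≤C 0≤x ≤-refl x≤y y≤1)) ⟩
    B * (y - x) + C * square (y - x)
      ≤⟨ +-mono-≤ ≤-refl (*-monoˡ-≤ 0≤C (*-monoˡ-≤ 0≤w w≤1)) ⟩
    B * (y - x) + C * ((y - x) * 1#)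
      ≈⟨ solve 3 (λ B C w → B :* w :+ C :* (w :* con 1ℚ) := (B :+ C) :* w) R.refl B C (y - x) ⟩
    (B + C) * (y - x) ∎

*-derivative : ∀ {F f G g} → HasDerivative F f → HasDerivative G g →
               HasDerivative (λ x → F x * G x) (λ x → f x * G x + F x * g x)
*-derivative D E .cong x≈y = R.*-cong (D .cong x≈y) (E .cong x≈y)
*-derivative D E .value = let C , F≤C = D .value ; B , G≤B = E .value in
  C * B , λ 0≤x x≤1 → ∣*∣≤ (F≤C 0≤x x≤1) (G≤B 0≤x x≤1)
*-derivative D E .slope = let C , F≤C = D .value ; C′ , f≤C′ = D .slope
                              B , G≤B = E .value ; B′ , g≤B′ = E .slope in
  C′ * B + C * B′ , λ 0≤x x≤1 →
    ∣+∣≤ (∣*∣≤ (f≤C′ 0≤x x≤1) (G≤B 0≤x x≤1)) (∣*∣≤ (F≤C 0≤x x≤1) (g≤B′ 0≤x x≤1))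
*-derivative {F} {f} {G} {g} D E .error =
  let C , F≤C = D .value ; C′ , f≤C′ = D .slope ; C″ , e≤C″ = D .error ; L , 0≤L , F≤L = lipschitz D
      B , G≤B = E .value ; B′ , g≤B′ = E .slope ; B″ , e≤B″ = E .error ; M , 0≤M , G≤M = lipschitz E
  in C * B″ + B * C″ + (B′ * L + C′ * M) , λ {x} {t} {y} 0≤x x≤t t≤y y≤1 →
  let w = y - x
      0≤t = ≤-trans 0≤x x≤t ; t≤1 = ≤-trans t≤y y≤1
      x≤y = ≤-trans x≤t t≤y ; 0≤y = ≤-trans 0≤x x≤y ; x≤1 = ≤-trans x≤y y≤1
      ∣w∣≤w = ≤-reflexive (0≤x⇒∣x∣≈x (x≤y⇒0≤y-x x≤y))
      y-t≤w : y - t ≤ w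
      y-t≤w = 0≤y-x⇒x≤y (≤-trans (x≤y⇒0≤y-x x≤t) (≤-reflexive
        (solve 3 (λ x t y → t :- x := (y :- x) :- (y :- t)) R.refl x t y)))
      t-x≤w : t - x ≤ w
      t-x≤w = +-mono-≤ t≤y ≤-refl
  in begin
    ∣ (f t * G t + F t * g t) * w - (F y * G y - F x * G x) ∣
      -- From F(y)G(y) - F(x)G(x) = F(y)(G(y)-G(x)) + G(x)(F(y)-F(x)), the first two terms are
      -- errors of the factors. The last two move F from y to t and G from x to t; the Lipschitz
      -- bounds and the extra factor w make them quadratic in w.
      ≈⟨ ∣∣-cong (solve 9 (λ ft gt Fx Ft Fy Gx Gt Gy w →
           (ft :* Gt :+ Ft :* gt) :* w :- (Fy :* Gy :- Fx :* Gx) :=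
           Fy :* (gt :* w :- (Gy :- Gx)) :+ Gx :* (ft :* w :- (Fy :- Fx)) :+
           (:- gt :* (Fy :- Ft) :* w :+ ft :* (Gt :- Gx) :* w))
           R.refl (f t) (g t) (F x) (F t) (F y) (G x) (G t) (G y) w) ⟩
    ∣ F y * (g t * w - (G y - G x)) + G x * (f t * w - (F y - F x)) +
      (- g t * (F y - F t) * w + f t * (G t - G x) * w) ∣
      ≤⟨ ∣+∣≤ (∣+∣≤ (∣*∣≤ (F≤C 0≤y y≤1) (e≤B″ 0≤x x≤t t≤y y≤1))
                    (∣*∣≤ (G≤B 0≤x x≤1) (e≤C″ 0≤x x≤t t≤y y≤1)))
              (∣+∣≤ (∣*∣≤ (∣*∣≤ (≤-trans (≤-reflexive (∣-x∣≈∣x∣ (g t))) (g≤B′ 0≤t t≤1))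
                                (≤-trans (F≤L 0≤t t≤y y≤1) (*-monoˡ-≤ 0≤L y-t≤w))) ∣w∣≤w)
                    (∣*∣≤ (∣*∣≤ (f≤C′ 0≤t t≤1)
                                (≤-trans (G≤M 0≤x x≤t t≤1) (*-monoˡ-≤ 0≤M t-x≤w))) ∣w∣≤w)) ⟩
    C * (B″ * square w) + B * (C″ * square w) + (B′ * (L * w) * w + C′ * (M * w) * w)
      ≈⟨ solve 9 (λ C B″ B C″ B′ L C′ M w →
           C :* (B″ :* (w :* w)) :+ B :* (C″ :* (w :* w)) :+
             (B′ :* (L :* w) :* w :+ C′ :* (M :* w) :* w) :=
           (C :* B″ :+ B :* C″ :+ (B′ :* L :+ C′ :* M)) :* (w :* w))
           R.refl C B″ B C″ B′ L C′ M w ⟩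
    (C * B″ + B * C″ + (B′ * L + C′ * M)) * square w ∎

scale-derivative : ∀ {F f} c → HasDerivative F f → HasDerivative (λ x → c * F x) (λ x → c * f x)
scale-derivative {F} {f} c D = HasDerivative-resp (λ _ → R.refl)
  (λ x → solve 3 (λ c F f → con 0ℚ :* F :+ c :* f := c :* f) R.refl c (F x) (f x))
  (*-derivative (const-derivative c) D)

∑-derivative : ∀ n {F f : Fin n → ℝ → ℝ} → (∀ i → HasDerivative (F i) (f i)) →
               HasDerivative (λ x → ∑[ i < n ] F i x) (λ x → ∑[ i < n ] f i x)
∑-derivative zero    D = const-derivative 0#
∑-derivative (suc n) D = +-derivative (D zero) (∑-derivative n (λ i → D (suc i)))

-- `fromℕ n` is a fraction reduced by a gcd that does not compute for a variable `n`; coprimality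
-- with 1 puts it in lowest terms explicitly.
fromℕ-suc : ∀ n → fromℕ (suc n) ≈ 1# + fromℕ n
fromℕ-suc n = pointwise λ _ → ≡.sym (≡.trans
  (≡.cong (1ℚ ℚ.+_) (ℚₚ.normalize-coprime (Coprime.sym (1-coprimeTo n))))
  (≡.cong (λ i → (+ 1 ℤ.+ i) ℚ./ 1) (ℤₚ.*-identityʳ (+ n))))

-- Induction with the product rule. Starting from exponent `suc n` keeps a predecessor out of the
-- derivative.
^-derivative : ∀ {F f} n → HasDerivative F f →
               HasDerivative (λ x → F x ^ suc n) (λ x → fromℕ (suc n) * F x ^ n * f x)
^-derivative {F} {f} zero D = HasDerivative-resp (λ _ → R.refl)
  (λ x → solve 2 (λ F f → f :* con 1ℚ :+ F :* con 0ℚ := con 1ℚ :* con 1ℚ :* f) R.refl (F x) (f x))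
  (*-derivative D (const-derivative 1#))
^-derivative {F} {f} (suc n) D = HasDerivative-resp (λ _ → R.refl)
  (λ x → R.trans
    (solve 4 (λ F f P m → f :* (F :* P) :+ F :* (m :* P :* f) := (con 1ℚ :+ m) :* (F :* P) :* f)
      R.refl (F x) (f x) (F x ^ n) (fromℕ (suc n)))
    (R.*-congʳ (R.*-congʳ (R.sym (fromℕ-suc (suc n))))))
  (*-derivative D (^-derivative n D))

-- Riemann sums and the fundamental theorem

∣∑∣≤∑ : ∀ n {u v : Fin n → ℝ} → (∀ i → ∣ u i ∣ ≤ v i) → ∣ ∑[ i < n ] u i ∣ ≤ ∑[ i < n ] v i
∣∑∣≤∑ zero    _   = ≤-reflexive (0≤x⇒∣x∣≈x ≤-refl)
∣∑∣≤∑ (suc n) u≤v = ∣+∣≤ (u≤v zero) (∣∑∣≤∑ n (λ i → u≤v (suc i)))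

∑-telescope : ∀ n (u : Fin (suc n) → ℝ) →
              ∑[ i < n ] (u (suc i) - u (inject₁ i)) ≈ u (Fin.fromℕ n) - u zero
∑-telescope zero    u = R.sym (R.-‿inverseʳ (u zero))
∑-telescope (suc n) u = R.trans
  (R.+-congˡ (∑-telescope n (λ i → u (suc i))))
  (solve 3 (λ a b c → (b :- a) :+ (c :- b) := c :- a) R.refl
    (u zero) (u (suc zero)) (u (suc (Fin.fromℕ n))))

module _ {F f} (D : HasDerivative F f) where

  private
    C = D .error .proj₁

  -- Each term is an increment of `F` plus an error `e i`. The increments telescope to the claimed
  -- integral, and the widths bounding the errors telescope to 1.
  riemannSum-error : (P : TaggedPartition 0# 1#) → ∀ {δ} → (∀ i → width P i ≤ ι δ) →
                     ∣ riemannSum P f - (F 1# - F 0#) ∣ ≤ C * ι δ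
  riemannSum-error P {δ} width≤δ = begin
    ∣ riemannSum P f - (F 1# - F 0#) ∣
      ≈⟨ ∣∣-cong (R.+-cong (sum-cong-≋ {n} split) (R.-‿cong total)) ⟩
    ∣ ∑[ i < n ] (e i + ΔF i) - ∑[ i < n ] ΔF i ∣
      ≈⟨ ∣∣-cong (R.+-congʳ (∑-distrib-+ e ΔF)) ⟩
    ∣ ∑[ i < n ] e i + ∑[ i < n ] ΔF i - ∑[ i < n ] ΔF i ∣
      ≈⟨ ∣∣-cong (solve 2 (λ a b → a :+ b :- b := a) R.refl (∑[ i < n ] e i) (∑[ i < n ] ΔF i)) ⟩
    ∣ ∑[ i < n ] e i ∣
      ≤⟨ ∣∑∣≤∑ n e≤ ⟩
    ∑[ i < n ] (C * ι δ * width P i)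
      ≈⟨ *-distribˡ-sum {n} (C * ι δ) (width P) ⟨
    C * ι δ * ∑[ i < n ] width P i
      ≈⟨ R.*-congˡ (∑-telescope n (point P)) ⟩
    C * ι δ * (point P (Fin.fromℕ n) - point P zero)
      ≈⟨ R.*-congˡ (R.+-cong (end P) (R.-‿cong (start P))) ⟩
    C * ι δ * (1# - 0#)
      ≈⟨ solve 1 (λ a → a :* (con 1ℚ :- con 0ℚ) := a) R.refl (C * ι δ) ⟩
    C * ι δ ∎
    where
    n = size P
    ΔF e : Fin n → ℝ
    ΔF i = F (point P (suc i)) - F (point P (inject₁ i))
    e i = f (tag P i) * width P i - ΔF i

    split : ∀ i → f (tag P i) * width P i ≈ e i + ΔF i
    split i = solve 2 (λ a b → a := (a :- b) :+ b) R.refl (f (tag P i) * width P i) (ΔF i)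

    total : F 1# - F 0# ≈ ∑[ i < n ] ΔF i
    -- The outer division points equal 0 and 1 only up to `≈`, so `F` has to respect this equality.
    total = R.trans (R.+-cong (D .cong (R.sym (end P))) (R.-‿cong (D .cong (R.sym (start P)))))
      (R.sym (∑-telescope n (λ i → F (point P i))))

    step : ∀ i → point P (inject₁ i) ≤ point P (suc i)
    step i = ≤-trans (point≤tag P i) (tag≤point P i)
    -- The error bound is available only inside [0,1]. Monotonicity of the points is propagated
    -- upwards from 0 here and downwards from 1 below.
    0≤point : ∀ i → 0# ≤ point P i
    0≤point = <-weakInduction (λ i → 0# ≤ point P i) (≤-reflexive (R.sym (start P)))
      (λ i 0≤p → ≤-trans 0≤p (step i))
    point≤1 : ∀ i → point P i ≤ 1#
    point≤1 = >-weakInduction (λ i → point P i ≤ 1#) (≤-reflexive (end P))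
      (λ i p≤1 → ≤-trans (step i) p≤1)

    0≤C : 0# ≤ C
    0≤C = error-nonNeg D

    e≤ : ∀ i → ∣ e i ∣ ≤ C * ι δ * width P i
    e≤ i = begin
      ∣ e i ∣
        ≤⟨ D .error .proj₂ (0≤point (inject₁ i)) (point≤tag P i) (tag≤point P i) (point≤1 (suc i)) ⟩
      C * square (width P i)
        -- Only one of the two width factors is replaced by the mesh; the other is kept for the
        -- telescoping sum.
        ≤⟨ *-monoˡ-≤ 0≤C (*-monoʳ-≤ (x≤y⇒0≤y-x (step i)) (width≤δ i)) ⟩
      C * (ι δ * width P i)
        ≈⟨ R.*-assoc C (ι δ) (width P i) ⟨
      C * ι δ * width P i ∎

  derivative⇒integral : IsIntegral 0# 1# f (F 1# - F 0#)
  derivative⇒integral ε 0<ε = go (upper-bound C)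
    where
    go : ∃[ K ] (0ℚ ℚ.< K × C ≤ ι K) → ∃[ δ ] (0ℚ ℚ.< δ × ((P : TaggedPartition 0# 1#) →
           (∀ i → width P i ≤ ι δ) → ∣ riemannSum P f - (F 1# - F 0#) ∣ ≤ ι ε))
    go (K , 0<K , C≤K) = δ , 0<δ , λ P width≤δ → begin
      ∣ riemannSum P f - (F 1# - F 0#) ∣ ≤⟨ riemannSum-error P width≤δ ⟩
      C * ι δ                            ≤⟨ *-monoʳ-≤ (pointwise-≤ λ _ → ℚₚ.<⇒≤ 0<δ) C≤K ⟩
      ι K * ι δ                          ≈⟨ pointwise (λ _ → Kδ≡ε) ⟩
      ι ε                                ∎
      where
      instance
        K-pos = ℚ.positive 0<K
        K-nonZero = ℚₚ.pos⇒nonZero K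
      -- With δ = ε/K, the error bound Cδ is at most Kδ = ε.
      δ = ℚ.1/ K ℚ.* ε
      0<δ : 0ℚ ℚ.< δ
      0<δ = ℚₚ.positive⁻¹ δ {{ℚₚ.pos*pos⇒pos (ℚ.1/ K) {{ℚₚ.1/pos⇒pos K}} ε {{ℚ.positive 0<ε}}}}
      Kδ≡ε : K ℚ.* δ ≡ ε
      Kδ≡ε = ≡.trans (≡.sym (ℚₚ.*-assoc K (ℚ.1/ K) ε))
        (≡.trans (≡.cong (ℚ._* ε) (ℚₚ.*-inverseʳ K)) (ℚₚ.*-identityˡ ε))

IsIntegral-resp : ∀ {a b f g I J} → (∀ x → f x ≈ g x) → I ≈ J →
                  IsIntegral a b f I → IsIntegral a b g J
IsIntegral-resp f≈g I≈J ∫f ε 0<ε = let δ , 0<δ , h = ∫f ε 0<ε in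
  δ , 0<δ , λ P width≤δ → ≤-trans
    (≤-reflexive (∣∣-cong (R.+-cong
      (sum-cong-≋ {size P} (λ i → R.*-congʳ (R.sym (f≈g (tag P i))))) (R.-‿cong (R.sym I≈J)))))
    (h P width≤δ)

-- Beta integrals by repeated integration by parts

1^n≈1 : ∀ n → 1# ^ n ≈ 1#
1^n≈1 zero    = R.refl
1^n≈1 (suc n) = R.trans (R.*-identityˡ (1# ^ n)) (1^n≈1 n)

-- The real 1/(p+1), read off from the inverse of the one-factor product ⟨p+1⟩₁ = 1·(p+1+0).
1/suc_ : ℕ → ℝ
1/suc p = proj₁ (⟨⟩-inverse (+ suc p) 1)

1/suc-inverse : ∀ p → 1/suc p * fromℕ (suc p) ≈ 1#
1/suc-inverse p = R.trans
  (solve 2 (λ i m → i :* m := i :* (con 1ℚ :* (m :+ con 0ℚ))) R.refl (1/suc p) (fromℕ (suc p)))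
  (⟨⟩-inverse (+ suc p) 1 .proj₂ .proj₁)

-- The recursion is integration by parts for xᵏ(1-x)ᵖ.
antiderivative : ℕ → ℕ → ℝ → ℝ
antiderivative zero    p x = 1/suc p * - (1# - x) ^ suc p
antiderivative (suc k) p x = 1/suc p *
  (fromℕ (suc k) * antiderivative k (suc p) x - x ^ suc k * (1# - x) ^ suc p)

-- ∫₀¹ xᵏ(1-x)ᵖ dx = k! p! / (k+p+1)!
beta : ℕ → ℕ → ℝ
beta zero    p = 1/suc p
beta (suc k) p = 1/suc p * (fromℕ (suc k) * beta k (suc p))

neg-derivative : ∀ {F f} → HasDerivative F f → HasDerivative (λ x → - F x) (λ x → - f x)
neg-derivative {F} {f} D = HasDerivative-resp (λ x → -1*≈- (F x)) (λ x → -1*≈- (f x))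
  (scale-derivative (- 1#) D)
  where
  -1*≈- : ∀ x → - 1# * x ≈ - x
  -1*≈- = solve 1 (λ x → :- con 1ℚ :* x := :- x) R.refl

1-x-power-derivative : ∀ p → HasDerivative (λ x → (1# - x) ^ suc p)
                                           (λ x → - (fromℕ (suc p) * (1# - x) ^ p))
1-x-power-derivative p = HasDerivative-resp (λ _ → R.refl)
  (λ x → solve 1 (λ a → a :* (con 0ℚ :+ :- con 1ℚ) := :- a) R.refl (fromℕ (suc p) * (1# - x) ^ p))
  (^-derivative p (+-derivative (const-derivative 1#) (neg-derivative id-derivative)))

-- In the successor case, differentiating the power of x in the boundary term cancels the recursive
-- summand. What remains is (p+1)xᵏ⁺¹(1-x)ᵖ divided by p+1.
antiderivative-derivative : ∀ k p →
  HasDerivative (antiderivative k p) (λ x → x ^ k * (1# - x) ^ p)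
antiderivative-derivative zero p = HasDerivative-resp (λ _ → R.refl)
  (λ x → R.trans
    (solve 3 (λ i m Q → i :* (:- (:- (m :* Q))) := i :* m :* Q)
      R.refl (1/suc p) (fromℕ (suc p)) ((1# - x) ^ p))
    (R.*-congʳ (1/suc-inverse p)))
  (scale-derivative (1/suc p) (neg-derivative (1-x-power-derivative p)))
antiderivative-derivative (suc k) p = HasDerivative-resp (λ _ → R.refl)
  (λ x → R.trans
    (solve 7 (λ i m n X Q x y →
      i :* (n :* (X :* (y :* Q)) :+
        :- (n :* X :* con 1ℚ :* (y :* Q) :+ x :* X :* :- (m :* Q))) :=
      i :* m :* (x :* X :* Q))
      R.refl (1/suc p) (fromℕ (suc p)) (fromℕ (suc k)) (x ^ k) ((1# - x) ^ p) x (1# - x))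
    (R.trans (R.*-congʳ (1/suc-inverse p)) (R.*-identityˡ _)))
  (scale-derivative (1/suc p)
    (+-derivative (scale-derivative (fromℕ (suc k)) (antiderivative-derivative k (suc p)))
      (neg-derivative (*-derivative (^-derivative k id-derivative) (1-x-power-derivative p)))))

-- For a successor exponent the boundary term vanishes at both ends, through 1-x at 1 and through x
-- at 0, leaving the recursion of `beta`. For exponent 0 the endpoint 0 contributes 1/(p+1).
antiderivative-increment : ∀ k p → antiderivative k p 1# - antiderivative k p 0# ≈ beta k p
antiderivative-increment zero p = R.trans
  (solve 3 (λ i Z U → i :* :- ((con 1ℚ :- con 1ℚ) :* Z) :- i :* :- ((con 1ℚ :- con 0ℚ) :* U) := i :* U)
    R.refl (1/suc p) ((1# - 1#) ^ p) ((1# - 0#) ^ p))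
  (R.trans (R.*-congˡ (R.trans (^-congˡ p (pointwise λ _ → ≡.refl)) (1^n≈1 p)))
    (R.*-identityʳ (1/suc p)))
antiderivative-increment (suc k) p = R.trans
  (solve 8 (λ i n A₁ A₀ X Z Y U →
    i :* (n :* A₁ :- X :* ((con 1ℚ :- con 1ℚ) :* Z)) :- i :* (n :* A₀ :- con 0ℚ :* Y :* U) :=
    i :* (n :* (A₁ :- A₀)))
    R.refl (1/suc p) (fromℕ (suc k)) (antiderivative k (suc p) 1#) (antiderivative k (suc p) 0#)
    (1# ^ suc k) ((1# - 1#) ^ p) (0# ^ k) ((1# - 0#) ^ suc p))
  (R.*-congˡ (R.*-congˡ (antiderivative-increment k (suc p))))

-- Rising factorials against beta values and binomial coefficients

-- The definition appends the last factor; this peels off the first. A separate `c′` lets the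
-- shifted base be the embedding of a successor, equal to `1# + c` only up to `≈`.
⟨⟩-shift : ∀ {c c′} → c′ ≈ 1# + c → ∀ k → ⟨ c ⟩[ suc k ] ≈ c * ⟨ c′ ⟩[ k ]
⟨⟩-shift {c} {c′} c′≈1+c zero =
  solve 1 (λ c → con 1ℚ :* (c :+ con 0ℚ) := c :* con 1ℚ) R.refl c
⟨⟩-shift {c} {c′} c′≈1+c (suc k) = begin-equality
  ⟨ c ⟩[ suc k ] * (c + fromℕ (suc k))
    ≈⟨ R.*-cong (⟨⟩-shift c′≈1+c k) (R.+-congˡ (fromℕ-suc k)) ⟩
  c * ⟨ c′ ⟩[ k ] * (c + (1# + fromℕ k))
    ≈⟨ solve 3 (λ c r n → c :* r :* (c :+ (con 1ℚ :+ n)) := c :* (r :* (con 1ℚ :+ c :+ n)))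
         R.refl c ⟨ c′ ⟩[ k ] (fromℕ k) ⟩
  c * (⟨ c′ ⟩[ k ] * (1# + c + fromℕ k))
    ≈⟨ R.*-congˡ (R.*-congˡ (R.+-congʳ (R.sym c′≈1+c))) ⟩
  c * (⟨ c′ ⟩[ k ] * (c′ + fromℕ k)) ∎

-- Multiplied out, this is (p+1)B(k+1,p+1) = ⟨1⟩ₖ/⟨p+2⟩ₖ. The induction raises `p`: the recursion of
-- `beta` passes to `suc p`, and peeling p+2 off the rising factorial supplies the leading factor of
-- that hypothesis.
beta-⟨⟩ : ∀ k p → fromℕ (suc p) * beta k p * ⟨ fromℕ (p ℕ.+ 2) ⟩[ k ] ≈ ⟨ 1# ⟩[ k ]
beta-⟨⟩ zero p = R.trans (R.*-identityʳ _) (R.trans (R.*-comm _ _) (1/suc-inverse p))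
beta-⟨⟩ (suc k) p = begin-equality
  m * (i * (n * b)) * ⟨ fromℕ (p ℕ.+ 2) ⟩[ suc k ]
    ≈⟨ R.*-congˡ (⟨⟩-shift (fromℕ-suc (p ℕ.+ 2)) k) ⟩
  m * (i * (n * b)) * (fromℕ (p ℕ.+ 2) * r)
    -- `p ℕ.+ 2` does not reduce for a variable `p`; commuted, it becomes the `suc (suc p)` of the
    -- induction hypothesis.
    ≡⟨ ≡.cong (λ q → m * (i * (n * b)) * (fromℕ q * r)) (ℕₚ.+-comm p 2) ⟩
  m * (i * (n * b)) * (fromℕ (suc (suc p)) * r)
    ≈⟨ solve 6 (λ m i n b c r → m :* (i :* (n :* b)) :* (c :* r) := i :* m :* (c :* b :* r :* n))
         R.refl m i n b (fromℕ (suc (suc p))) r ⟩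
  i * m * (fromℕ (suc (suc p)) * b * r * n)
    ≈⟨ R.*-cong (1/suc-inverse p) (R.*-cong (beta-⟨⟩ k (suc p)) (fromℕ-suc k)) ⟩
  1# * (⟨ 1# ⟩[ k ] * (1# + fromℕ k))
    ≈⟨ R.*-identityˡ _ ⟩
  ⟨ 1# ⟩[ suc k ] ∎
  where
  m = fromℕ (suc p)
  i = 1/suc p
  n = fromℕ (suc k)
  b = beta k (suc p)
  r = ⟨ fromℕ (suc p ℕ.+ 2) ⟩[ k ]

-- Every factor ƛ-1-k takes the sign of one factor -x and becomes 1-ƛ+k.
falling-neg-power : ∀ ƛ x k → ⦅ ƛ - 1# ⦆[ k , 1# ] * (- x) ^ k ≈ ⟨ 1# - ƛ ⟩[ k ] * x ^ k
falling-neg-power ƛ x zero    = R.refl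
falling-neg-power ƛ x (suc k) = begin-equality
  ⦅ ƛ - 1# ⦆[ k , 1# ] * (ƛ - 1# - fromℕ k * 1#) * (- x * (- x) ^ k)
    ≈⟨ solve 5 (λ f l n x X → f :* (l :- con 1ℚ :- n :* con 1ℚ) :* (:- x :* X) :=
         f :* X :* ((con 1ℚ :- l :+ n) :* x)) R.refl ⦅ ƛ - 1# ⦆[ k , 1# ] ƛ (fromℕ k) x ((- x) ^ k) ⟩
  ⦅ ƛ - 1# ⦆[ k , 1# ] * (- x) ^ k * ((1# - ƛ + fromℕ k) * x)
    ≈⟨ R.*-congʳ (falling-neg-power ƛ x k) ⟩
  ⟨ 1# - ƛ ⟩[ k ] * x ^ k * ((1# - ƛ + fromℕ k) * x)
    ≈⟨ solve 4 (λ r X s x → r :* X :* (s :* x) := r :* s :* (x :* X))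
         R.refl ⟨ 1# - ƛ ⟩[ k ] (x ^ k) (1# - ƛ + fromℕ k) x ⟩
  ⟨ 1# - ƛ ⟩[ suc k ] * x ^ suc k ∎

-- Comparison of the coefficients of tⁿ

module _ (ƛ : ℝ) (p n : ℕ) where

  -- The part of the k-th term that both sides share; its formula involves neither x nor `p`.
  coefficient : ℕ → ℝ
  coefficient k = ⟨ 1# - ƛ ⟩[ k ] * 1/! k * (1-e[ ƛ ] ^ₛ k) n

  integralCoefficient : ℝ
  integralCoefficient = ∑[ k ≤ n ] (coefficient (toℕ k) * beta (toℕ k) p)

  -- The composition stops at k = n, so each coefficient is a finite sum, polynomial in x, and
  -- termwise integration raises no convergence question.
  integrand-expansion : ∀ x → ∑[ k ≤ n ] (coefficient (toℕ k) * (x ^ toℕ k * (1# - x) ^ p)) ≈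
                              integrand ƛ p x n
  integrand-expansion x = R.sym (R.trans
    (*-distribˡ-sum {suc n} ((1# - x) ^ p)
      (λ k → binom (ƛ - 1#) (toℕ k) * (- x) ^ toℕ k * (1-e[ ƛ ] ^ₛ toℕ k) n))
    (sum-cong-≋ {suc n} (λ k → term (toℕ k))))
    where
    term : ∀ k → (1# - x) ^ p * (binom (ƛ - 1#) k * (- x) ^ k * (1-e[ ƛ ] ^ₛ k) n) ≈
                 coefficient k * (x ^ k * (1# - x) ^ p)
    term k = begin-equality
      (1# - x) ^ p * (⦅ ƛ - 1# ⦆[ k , 1# ] * 1/! k * (- x) ^ k * g)
        ≈⟨ solve 5 (λ Q f v X g → Q :* (f :* v :* X :* g) := f :* X :* (v :* g :* Q))
             R.refl ((1# - x) ^ p) ⦅ ƛ - 1# ⦆[ k , 1# ] (1/! k) ((- x) ^ k) g ⟩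
      ⦅ ƛ - 1# ⦆[ k , 1# ] * (- x) ^ k * (1/! k * g * (1# - x) ^ p)
        ≈⟨ R.*-congʳ (falling-neg-power ƛ x k) ⟩
      ⟨ 1# - ƛ ⟩[ k ] * x ^ k * (1/! k * g * (1# - x) ^ p)
        ≈⟨ solve 5 (λ r X v g Q → r :* X :* (v :* g :* Q) := r :* v :* g :* (X :* Q))
             R.refl ⟨ 1# - ƛ ⟩[ k ] (x ^ k) (1/! k) g ((1# - x) ^ p) ⟩
      coefficient k * (x ^ k * (1# - x) ^ p) ∎
      where g = (1-e[ ƛ ] ^ₛ k) n

  integrand-integral : IsIntegral 0# 1# (λ x → integrand ƛ p x n) integralCoefficient
  integrand-integral = IsIntegral-resp integrand-expansion increment
    (derivative⇒integral (∑-derivative (suc n)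
      (λ k → scale-derivative (coefficient (toℕ k)) (antiderivative-derivative (toℕ k) p))))
    where
    c : Fin (suc n) → ℝ
    c k = coefficient (toℕ k)
    A : ℝ → Fin (suc n) → ℝ
    A x k = antiderivative (toℕ k) p x
    ΔA : Fin (suc n) → ℝ
    ΔA k = c k * (A 1# k - A 0# k)

    increment : ∑[ k ≤ n ] (c k * A 1# k) - ∑[ k ≤ n ] (c k * A 0# k) ≈ integralCoefficient
    increment = begin-equality
      ∑[ k ≤ n ] (c k * A 1# k) - ∑[ k ≤ n ] (c k * A 0# k)
        ≈⟨ R.+-congʳ (sum-cong-≋ {suc n} (λ k →
             -- Each upper value is written as increment plus lower value, so that the sums of lower
             -- values cancel.
             solve 3 (λ c u v → c :* u := c :* (u :- v) :+ c :* v) R.refl (c k) (A 1# k) (A 0# k))) ⟩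
      ∑[ k ≤ n ] (ΔA k + c k * A 0# k) - ∑[ k ≤ n ] (c k * A 0# k)
        ≈⟨ R.+-congʳ (∑-distrib-+ ΔA (λ k → c k * A 0# k)) ⟩
      ∑[ k ≤ n ] ΔA k + ∑[ k ≤ n ] (c k * A 0# k) - ∑[ k ≤ n ] (c k * A 0# k)
        ≈⟨ solve 2 (λ a b → a :+ b :- b := a) R.refl (∑[ k ≤ n ] ΔA k) (∑[ k ≤ n ] (c k * A 0# k)) ⟩
      ∑[ k ≤ n ] ΔA k
        ≈⟨ sum-cong-≋ {suc n} (λ k → R.*-congˡ {c k} (antiderivative-increment (toℕ k) p)) ⟩
      integralCoefficient ∎

  F-coefficient : F[ ƛ , + p ] -≤+ n ≈ fromℕ (suc p) * integralCoefficient
  F-coefficient = R.trans (sum-cong-≋ {suc n} (λ k → term (toℕ k)))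
    (R.sym (*-distribˡ-sum {suc n} (fromℕ (suc p)) (λ k → coefficient (toℕ k) * beta (toℕ k) p)))
    where
    c⁻¹ = ⟨⟩-inverse (+ p ℤ.+ + 2) {{p+2-positive (+ p) -≤+}}

    term : ∀ k → ₂F₁ (1# - ƛ) 1# (fromℕ (p ℕ.+ 2)) c⁻¹ k * (1-e[ ƛ ] ^ₛ k) n ≈
                 fromℕ (suc p) * (coefficient k * beta k p)
    term k = begin-equality
      r * ⟨ 1# ⟩[ k ] * u * v * g
        -- Replacing ⟨1⟩ₖ by its beta form introduces ⟨p+2⟩ₖ, which cancels against the inverse `u`
        -- from the hypergeometric coefficient.
        ≈⟨ R.*-congʳ (R.*-congʳ (R.*-congʳ (R.*-congˡ (R.sym (beta-⟨⟩ k p))))) ⟩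
      r * (m * b * c) * u * v * g
        ≈⟨ solve 7 (λ r m b c u v g →
             r :* (m :* b :* c) :* u :* v :* g := u :* c :* (m :* (r :* v :* g :* b)))
             R.refl r m b c u v g ⟩
      u * c * (m * (coefficient k * b))
        ≈⟨ R.*-congʳ (c⁻¹ k .proj₂ .proj₁) ⟩
      1# * (m * (coefficient k * b))
        ≈⟨ R.*-identityˡ _ ⟩
      m * (coefficient k * b) ∎
      where
      r = ⟨ 1# - ƛ ⟩[ k ]
      m = fromℕ (suc p)
      b = beta k p
      c = ⟨ fromℕ (p ℕ.+ 2) ⟩[ k ]
      u = c⁻¹ k .proj₁
      v = 1/! k
      g = (1-e[ ƛ ] ^ₛ k) n

theorem6 : (ƛ : ℝ) (p : ℕ) →
    ∃[ I ] (IsCoefficientwiseIntegral 0# 1# (integrand ƛ p) I ×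
    egf (β[ ƛ , + p ] -≤+) ≋ fromℕ (suc p) · I)
theorem6 ƛ p = integralCoefficient ƛ p , integrand-integral ƛ p ,
  λ n → R.trans (R.sym (β-generating ƛ (+ p) -≤+ n)) (F-coefficient ƛ p n)
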